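{- For every finite tree $T$, $\operatorname{pw}(T)\le \mathcal{L}(T)\le \operatorname{pw}(T)+1$.
   Context: Lions and contamination game. Let $G=(V,E)$ be a finite graph, $N(v)$ the set of neighbours of $v$. A lion strategy with $k\ge 1$ lions consists of initial positions $p_1(0),\dots,p_k(0)\in V$ and, for each $t\ge 1$, positions $p_i(t)\in\{p_i(t-1)\}\cup N(p_i(t-1))$. Put $L_t=\{p_i(t)\}_i$, $\pi_t=\{(p_i(t-1),p_i(t))\}_i$. Contaminated sets: $W_0=V\setminus L_0$, and for $t\ge1$, $W_t=(W_{t-1}\setminus L_t)\cup\{v\in V\setminus L_t:\exists w\in W_{t-1}\cap N(v)\text{ with }(v,w)\notin\pi_t,(w,v)\notin\pi_t\}$. The strategy clears $G$ if $W_T=\emptyset$ for some $T$; $\mathcal{L}(G)$ is the minimum number of lions of a clearing strategy. Pathwidth: a path decomposition of $G$ is a sequence $(\mathcal{B}_1,\dots,\mathcal{B}_n)$ of subsets of $V$ covering $V$, such that each edge lies in some $\mathcal{B}_i$ and each vertex lies in a set of consecutive bags; its width is $\max_i|\mathcal{B}_i|-1$, and $\operatorname{pw}(G)$ is the minimum width. -}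

module Defs where

open import Data.Nat using (ℕ; zero; suc; _≤_; _<_; _∸_; _⊔_)
open import Data.Fin using (Fin; inject₁; fromℕ) renaming (zero to fzero; suc to fsuc; _≤_ to _≤ᶠ_)
open import Data.Fin.Subset using (Subset; _∈_; ∣_∣)
open import Data.Bool using (Bool; true; false)
open import Data.Product using (Σ; ∃; _×_; _,_)
open import Data.Sum using (_⊎_)
open import Data.Empty using (⊥)
open import Relation.Nullary using (¬_)
open import Relation.Binary.PropositionalEquality using (_≡_)
open import Function.Definitions using (Injective)

record Graph : Set where
  field
    n     : ℕ
    adj   : Fin n → Fin n → Bool
    sym   : ∀ u v → adj u v ≡ adj v u
    irrefl : ∀ v → adj v v ≡ false

open Graph public

Adj : (G : Graph) → Fin (n G) → Fin (n G) → Set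
Adj G u v = adj G u v ≡ true

data Walk (G : Graph) : Fin (n G) → Fin (n G) → Set where
  here : ∀ {v} → Walk G v v
  step : ∀ {u w v} → Adj G u w → Walk G w v → Walk G u v

Connected : Graph → Set
Connected G = ∀ u v → Walk G u v

Cycle : Graph → Set
Cycle G = Σ ℕ λ k → Σ (Fin (suc (suc (suc k))) → Fin (n G)) λ c →
  Injective _≡_ _≡_ c ×
  (∀ (i : Fin (suc (suc k))) → Adj G (c (inject₁ i)) (c (fsuc i))) ×
  Adj G (c (fromℕ (suc (suc k)))) (c fzero)

Acyclic : Graph → Set
Acyclic G = ¬ Cycle G

IsTree : Graph → Set
IsTree G = (0 < n G) × Connected G × Acyclic G

record LionStrategy (G : Graph) (k : ℕ) : Set where
  field
    pos   : ℕ → Fin k → Fin (n G)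
    moves : ∀ t i → pos (suc t) i ≡ pos t i ⊎ Adj G (pos t i) (pos (suc t) i)

open LionStrategy public

module _ {G : Graph} {k : ℕ} (S : LionStrategy G k) where

  InL : ℕ → Fin (n G) → Set
  InL t v = ∃ λ (i : Fin k) → pos S t i ≡ v

  -- (a , b) ∈ π_{t+1}
  InΠ : ℕ → Fin (n G) → Fin (n G) → Set
  InΠ t a b = ∃ λ (i : Fin k) → (pos S t i ≡ a) × (pos S (suc t) i ≡ b)

  W : ℕ → Fin (n G) → Set
  W zero v = ¬ InL zero v
  W (suc t) v = ¬ InL (suc t) v ×
    (W t v ⊎ (∃ λ w → W t w × Adj G v w × ¬ InΠ t v w × ¬ InΠ t w v))

  Clears : Set
  Clears = ∃ λ T → ∀ v → ¬ W T v

ClearableWith : Graph → ℕ → Set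
ClearableWith G k = (1 ≤ k) × Σ (LionStrategy G k) Clears

IsLionNumber : Graph → ℕ → Set
IsLionNumber G m = ClearableWith G m × (∀ k → ClearableWith G k → m ≤ k)

record PathDecomposition (G : Graph) : Set where
  field
    len  : ℕ
    bag  : Fin len → Subset (n G)
    cover : ∀ v → ∃ λ i → v ∈ bag i
    edges : ∀ u v → Adj G u v → ∃ λ i → (u ∈ bag i) × (v ∈ bag i)
    consecutive : ∀ v (i j l : Fin len) → i ≤ᶠ j → j ≤ᶠ l →
                  v ∈ bag i → v ∈ bag l → v ∈ bag j

open PathDecomposition public

maxFin : ∀ {m} → (Fin m → ℕ) → ℕ
maxFin {zero} f = 0
maxFin {suc m} f = f fzero ⊔ maxFin (λ i → f (fsuc i))

width : ∀ {G} → PathDecomposition G → ℕ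
width D = maxFin (λ i → ∣ bag D i ∣) ∸ 1

IsPathwidth : Graph → ℕ → Set
IsPathwidth G w = (Σ (PathDecomposition G) λ D → width D ≡ w) ×
                  (∀ (D : PathDecomposition G) → w ≤ width D)

{-# OPTIONS --safe #-}
module Submission where

-- For k ≥ 1, a tree has pathwidth at least k + 1 iff it has a vertex v with three branches of
-- pathwidth at least k.  Iterating this down to a single edge gives an obstruction.  If there is none, the
-- components that need width k are strung along a path whose removal leaves only lighter ones, and
-- the layouts of those, each enlarged by a vertex of the path, concatenate to a layout of width k.
-- Conversely, three bags that are large in three branches at v have a middle one, which also meets
-- the connected union of v and the other two branches.
--
-- A layout with bags of size m lets m lions sweep a connected graph: a lion not needed in the
-- separator walks to the next vertex of the bag, however far away.
--
-- k - 1 lions cannot clear a tree with an obstruction of order k, although contamination spreads at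
-- the speed of a lion only.  Contamination is an evader who knows the future and moves at speed one.
-- When all lions are in one branch at v, he can be at v.  Between two consecutive such times one of
-- the three branches is neither the one just left nor the next one to be visited; he hides there,
-- where by induction he escapes from all lions but one and is back at the root in time.
--
-- Whether pw(T) or pw(T) + 1 lions are needed is decided by reachability in the finite graph of
-- lion positions and contaminated sets.

open import Defs
open import Data.Bool using (true; false)
import Data.Bool.Properties as Bool
open import Data.Empty using (⊥; ⊥-elim)
open import Data.Fin using (Fin; inject₁; fromℕ; fromℕ<; punchIn; punchOut) renaming (zero to fzero; suc to fsuc; _≤_ to _≤ᶠ_)
import Data.Fin.Properties as Fin
open import Data.Fin.Subset using (Subset; _∈_; _∉_; _⊆_; _⊂_; _⊃_; _∪_; _∩_; ⁅_⁆; ⊤; ∣_∣; Nonempty) renaming (⊥ to ∅)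
open import Data.Fin.Subset.Induction using (⊃-wellFounded; ⊂-wellFounded; Acc; acc)
open import Data.Fin.Subset.Properties using (_∈?_; nonempty?; Empty-unique; ∈⊤; ∉⊥; x∈p∪q⁺; x∈p∪q⁻; x∈p∩q⁺; x∈p∩q⁻; x∈⁅x⁆; x∈⁅y⁆⇒x≡y; ∪-identityˡ; p⊂q⇒∣p∣<∣q∣; ∣⁅x⁆∣≡1; ∣⊥∣≡0; ∣p∣≤n; ∣p∣≤∣x∷p∣; ∣p∩q∣≤∣p∣)
open import Data.List as List using (List; []; _∷_; _++_; map; length; lookup; reverse; foldr; allFin)
import Data.List.Membership.DecPropositional as DecMembership
open import Data.List.Membership.Propositional using (lose) renaming (_∈_ to _∈ₗ_; _∉_ to _∉ₗ_)
open import Data.List.Membership.Propositional.Properties using (∈-lookup; ∈-allFin; ∈-cartesianProductWith⁺; ∈-cartesianProduct⁺)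
import Data.List.Properties as List
open import Data.List.Relation.Unary.All as All using (All; []; _∷_)
import Data.List.Relation.Unary.All.Properties as All
open import Data.List.Relation.Unary.Any as Any using (Any; here; there)
import Data.List.Relation.Unary.Any.Properties as Any
open import Data.Nat using (ℕ; zero; suc; _+_; _≤_; _<_; z≤n; s≤s)
import Data.Nat.Properties as ℕ
open import Data.Product using (Σ; ∃; ∃₂; _×_; _,_; proj₁; proj₂)
open import Data.Sum as Sum using (_⊎_; inj₁; inj₂; [_,_]′)
open import Data.Unit using (tt) renaming (⊤ to Unit)
open import Data.Vec as Vec using (Vec; []; _∷_; tabulate)
import Data.Vec.Properties as Vec
open import Function using (_∘_; id; case_of_)
open import Relation.Binary.Construct.Closure.ReflexiveTransitive using (Star; ε; _◅_; _◅◅_)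
open import Relation.Binary.PropositionalEquality as ≡ using (_≡_; _≢_; refl; cong; subst)
open import Relation.Nullary using (¬_; Dec; yes; no; does; contradiction)
open import Relation.Nullary.Decidable using (map′; _×-dec_; _⊎-dec_; _→-dec_; ¬?; dec-true)
open import Relation.Unary using (Decidable)

-- Decidable subsets and reachability in finite sets.

module _ {N : ℕ} {P : Fin N → Set} (P? : Decidable P) where

  comprehension : Subset N
  comprehension = tabulate (does ∘ P?)

  ∈-comprehension⁺ : ∀ {v} → P v → v ∈ comprehension
  ∈-comprehension⁺ {v} pv = Vec.lookup⇒[]= v _
    (≡.trans (Vec.lookup∘tabulate (does ∘ P?) v) (dec-true (P? v) pv))

  ∈-comprehension⁻ : ∀ {v} → v ∈ comprehension → P v
  ∈-comprehension⁻ {v} v∈ with P? v | ≡.trans (≡.sym (Vec.lookup∘tabulate (does ∘ P?) v)) (Vec.[]=⇒lookup v∈)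
  ... | yes pv | _ = pv
  ... | no _ | ()

module _ {N : ℕ} {R : Fin N → Fin N → Set} (R? : ∀ u v → Dec (R u v)) (s : Fin N) where

  private
    -- Saturation: while some edge leaves `S`, its end is added. The set grows strictly inside a
    -- finite one, so this stops, at a set closed under `R`.
    close : ∀ S → Acc _⊃_ S → s ∈ S → (∀ {w} → w ∈ S → Star R s w) →
            ∃ λ S′ → s ∈ S′ × (∀ {w} → w ∈ S′ → Star R s w) × (∀ {u w} → u ∈ S′ → R u w → w ∈ S′)
    close S (acc rec) s∈S sound
      with Fin.any? (λ u → Fin.any? (λ w → u ∈? S ×-dec R? u w ×-dec ¬? (w ∈? S)))
    ... | no closed = S , s∈S , sound , λ {u} {w} u∈S r → case w ∈? S of λ where
          (yes w∈S) → w∈S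
          (no w∉S) → contradiction (u , w , u∈S , r , w∉S) closed
    ... | yes (u , w , u∈S , r , w∉S) =
          close (S ∪ ⁅ w ⁆)
            (rec ((x∈p∪q⁺ ∘ inj₁) , w , x∈p∪q⁺ (inj₂ (x∈⁅x⁆ w)) , w∉S))
            (x∈p∪q⁺ (inj₁ s∈S))
            (λ x∈ → case x∈p∪q⁻ S ⁅ w ⁆ x∈ of λ where
              (inj₁ x∈S) → sound x∈S
              (inj₂ x∈w) → subst (Star R s) (≡.sym (x∈⁅y⁆⇒x≡y w x∈w)) (sound u∈S ◅◅ r ◅ ε))

  star? : Decidable (Star R s)
  star? w with close ⁅ s ⁆ (⊃-wellFounded _) (x∈⁅x⁆ s)
                 (λ x∈ → subst (Star R s) (≡.sym (x∈⁅y⁆⇒x≡y s x∈)) ε)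
  ... | S , s∈S , sound , closed = map′ sound (complete s∈S) (w ∈? S)
    where
    complete : ∀ {u} → u ∈ S → Star R u w → w ∈ S
    complete u∈S ε = u∈S
    complete u∈S (r ◅ rs) = complete (closed u∈S r) rs

-- Walks and components

module Components (G : Graph) where

  Vtx : Set
  Vtx = Fin (n G)

  adj? : ∀ u v → Dec (Adj G u v)
  adj? u v = adj G u v Bool.≟ true

  adj-sym : ∀ {u v} → Adj G u v → Adj G v u
  adj-sym {u} {v} e = ≡.trans (sym G v u) e

  adj⇒≢ : ∀ {u v} → Adj G u v → u ≢ v
  adj⇒≢ {u} e refl with ≡.trans (≡.sym e) (irrefl G u)
  ... | ()

  data Reach (P : Vtx → Set) : Vtx → Vtx → Set where
    here : ∀ {a} → P a → Reach P a a
    step : ∀ {a b c} → P a → Adj G a b → Reach P b c → Reach P a c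

  reach-source : ∀ {P a b} → Reach P a b → P a
  reach-source (here p) = p
  reach-source (step p _ _) = p

  reach-target : ∀ {P a b} → Reach P a b → P b
  reach-target (here p) = p
  reach-target (step _ _ r) = reach-target r

  reach-map : ∀ {P Q : Vtx → Set} {a b} → (∀ {w} → P w → Q w) → Reach P a b → Reach Q a b
  reach-map f (here p) = here (f p)
  reach-map f (step p e r) = step (f p) e (reach-map f r)

  reach-trans : ∀ {P a b c} → Reach P a b → Reach P b c → Reach P a c
  reach-trans (here _) s = s
  reach-trans (step p e r) s = step p e (reach-trans r s)

  reach-snoc : ∀ {P a b c} → Reach P a b → Adj G b c → P c → Reach P a c
  reach-snoc r e p = reach-trans r (step (reach-target r) e (here p))

  reach-sym : ∀ {P a b} → Reach P a b → Reach P b a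
  reach-sym (here p) = here p
  reach-sym (step p e r) = reach-snoc (reach-sym r) (adj-sym e) p

  reach? : ∀ {P} → Decidable P → ∀ a b → Dec (Reach P a b)
  reach? {P} P? a b = map′ (λ (p , r) → from p r) (λ r → reach-source r , to r) (P? a ×-dec star? E? a b)
    where
    E : Vtx → Vtx → Set
    E u w = Adj G u w × P w
    E? : ∀ u w → Dec (E u w)
    E? u w = adj? u w ×-dec P? w
    from : ∀ {a} → P a → Star E a b → Reach P a b
    from p ε = here p
    from p ((e , q) ◅ r) = step p e (from q r)
    to : ∀ {a} → Reach P a b → Star E a b
    to (here _) = ε
    to (step _ e r) = (e , reach-source r) ◅ to r

  reach-length : ∀ {P a b} → Reach P a b → ℕ
  reach-length (here _) = 0
  reach-length (step _ _ r) = suc (reach-length r)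

  infixl 6 _∖_
  _∖_ : (Vtx → Set) → Vtx → Vtx → Set
  (P ∖ u) w = P w × w ≢ u

  -- The walk is cut behind its last visit to `u`. The bounds on the length drive the recursion in
  -- `simple-path`.
  last-exit : ∀ {P a b} u (r : Reach P a b) → b ≢ u →
    (Σ (Reach (P ∖ u) a b) λ r′ → reach-length r′ ≤ reach-length r) ⊎
    (∃ λ c → Adj G u c × Σ (Reach (P ∖ u) c b) λ r′ → reach-length r′ < reach-length r)
  last-exit u (here p) b≢u = inj₁ (here (p , b≢u) , z≤n)
  last-exit u (step {a} p e r) b≢u with last-exit u r b≢u
  ... | inj₂ (c , e′ , r′ , lt) = inj₂ (c , e′ , r′ , ℕ.m≤n⇒m≤1+n lt)
  ... | inj₁ (r′ , le) with a Fin.≟ u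
  ...   | yes refl = inj₂ (_ , e , r′ , s≤s le)
  ...   | no a≢u = inj₁ (step (p , a≢u) e r′ , s≤s le)

  first-step : ∀ {P a b} (r : Reach P a b) → b ≢ a →
    ∃ λ c → Adj G a c × Σ (Reach (P ∖ a) c b) λ r′ → reach-length r′ < reach-length r
  first-step {a = a} r b≢a with last-exit a r b≢a
  ... | inj₁ (r′ , _) = contradiction refl (proj₂ (reach-source r′))
  ... | inj₂ found = found

  -- Simplicity is built into the index: the rest of the path lives in `P` without the vertex just
  -- left. In `travel` this index shows that the path never turns back.
  data SimplePath (P : Vtx → Set) (a : Vtx) : Vtx → Set where
    done : P a → SimplePath P a a
    step : ∀ {b c} → P a → Adj G a b → SimplePath (P ∖ a) b c → SimplePath P a c

  simple-path : ∀ {P a b} → Reach P a b → SimplePath P a b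
  simple-path r = shorten (reach-length r) r ℕ.≤-refl
    where
    shorten : ∀ {P a b} m (r : Reach P a b) → reach-length r ≤ m → SimplePath P a b
    shorten {a = a} {b} m r le with b Fin.≟ a
    ... | yes refl = done (reach-source r)
    ... | no b≢a with first-step r b≢a
    shorten zero r le | no b≢a | c , e , r′ , lt = contradiction (ℕ.<-≤-trans lt le) λ ()
    shorten (suc m) r le | no b≢a | c , e , r′ , lt =
      step (reach-source r) e (shorten m r′ (ℕ.≤-pred (ℕ.<-≤-trans lt le)))

  path-source : ∀ {P a b} → SimplePath P a b → P a
  path-source (done p) = p
  path-source (step p _ _) = p

  path-length : ∀ {P a b} → SimplePath P a b → ℕ
  path-length (done _) = 0
  path-length (step _ _ s) = suc (path-length s)

  vertex : ∀ {P a b} (s : SimplePath P a b) → Fin (suc (path-length s)) → Vtx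
  vertex {a = a} s fzero = a
  vertex (step _ _ s) (fsuc i) = vertex s i

  vertex-∈ : ∀ {P a b} (s : SimplePath P a b) i → P (vertex s i)
  vertex-∈ s fzero = path-source s
  vertex-∈ (step _ _ s) (fsuc i) = proj₁ (vertex-∈ s i)

  vertex-injective : ∀ {P a b} (s : SimplePath P a b) {i j} → vertex s i ≡ vertex s j → i ≡ j
  vertex-injective s {fzero} {fzero} eq = refl
  vertex-injective (step _ _ s) {fzero} {fsuc j} eq = contradiction (≡.sym eq) (proj₂ (vertex-∈ s j))
  vertex-injective (step _ _ s) {fsuc i} {fzero} eq = contradiction eq (proj₂ (vertex-∈ s i))
  vertex-injective (step _ _ s) {fsuc i} {fsuc j} eq = cong fsuc (vertex-injective s eq)

  vertex-adj : ∀ {P a b} (s : SimplePath P a b) i → Adj G (vertex s (inject₁ i)) (vertex s (fsuc i))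
  vertex-adj (step _ e s) fzero = e
  vertex-adj (step _ e s) (fsuc i) = vertex-adj s i

  vertex-last : ∀ {P a b} (s : SimplePath P a b) → vertex s (fromℕ (path-length s)) ≡ b
  vertex-last (done _) = refl
  vertex-last (step _ _ s) = vertex-last s

  -- A simple path from `x` to `z` that avoids `y` closes up through `y` to a cycle, unless it has
  -- no edge at all.
  unique-neighbour : Acyclic G → ∀ {y x z} → Adj G y x → Adj G y z → Reach (_≢ y) x z → x ≡ z
  unique-neighbour acyclic {y} {x} {z} ex ez r with simple-path r
  ... | done _ = refl
  ... | s@(step _ _ s′) = ⊥-elim (acyclic (path-length s′ , c , c-injective , c-adj , c-close))
    where
    c : Fin (suc (suc (suc (path-length s′)))) → Vtx
    c fzero = y
    c (fsuc i) = vertex s i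
    c-injective : ∀ {i j} → c i ≡ c j → i ≡ j
    c-injective {fzero} {fzero} eq = refl
    c-injective {fzero} {fsuc j} eq = contradiction (≡.sym eq) (vertex-∈ s j)
    c-injective {fsuc i} {fzero} eq = contradiction eq (vertex-∈ s i)
    c-injective {fsuc i} {fsuc j} eq = cong fsuc (vertex-injective s eq)
    c-adj : ∀ i → Adj G (c (inject₁ i)) (c (fsuc i))
    c-adj fzero = ex
    c-adj (fsuc i) = vertex-adj s i
    c-close : Adj G (vertex s (fromℕ (path-length s))) y
    c-close = subst (λ w → Adj G w y) (≡.sym (vertex-last s)) (adj-sym ez)

  IsConnected : Subset (n G) → Set
  IsConnected A = ∀ {a b} → a ∈ A → b ∈ A → Reach (_∈ A) a b

  private
    in? : ∀ A x → Decidable ((_∈ A) ∖ x)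
    in? A x w = w ∈? A ×-dec ¬? (w Fin.≟ x)

  abstract
    -- For a neighbour `y` of `x` in an acyclic graph, the branch of `A` at `x` towards `y`. Empty
    -- when `y` is `x` or lies outside `A`.
    comp : Subset (n G) → Vtx → Vtx → Subset (n G)
    comp A x y = comprehension (reach? (in? A x) y)

    comp⁺ : ∀ {A x y w} → Reach ((_∈ A) ∖ x) y w → w ∈ comp A x y
    comp⁺ {A} {x} {y} = ∈-comprehension⁺ (reach? (in? A x) y)

    comp⁻ : ∀ {A x y w} → w ∈ comp A x y → Reach ((_∈ A) ∖ x) y w
    comp⁻ {A} {x} {y} = ∈-comprehension⁻ (reach? (in? A x) y)

  comp-⊆ : ∀ {A x y} → comp A x y ⊆ A
  comp-⊆ = proj₁ ∘ reach-target ∘ comp⁻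

  comp-≢ : ∀ {A x y w} → w ∈ comp A x y → w ≢ x
  comp-≢ = proj₂ ∘ reach-target ∘ comp⁻

  comp-step : ∀ {A x y u w} → u ∈ comp A x y → Adj G u w → w ∈ A → w ≢ x → w ∈ comp A x y
  comp-step u∈ e w∈A w≢x = comp⁺ (reach-snoc (comp⁻ u∈) e (w∈A , w≢x))

  root∈comp : ∀ {A x y} → y ∈ A → Adj G x y → y ∈ comp A x y
  root∈comp y∈A e = comp⁺ (here (y∈A , adj⇒≢ (adj-sym e)))

  comp-connected : ∀ {A x y} → IsConnected (comp A x y)
  comp-connected {A} {x} {y} a∈ b∈ = reach-trans (reach-sym (inside (comp⁻ a∈))) (inside (comp⁻ b∈))
    where
    within : ∀ {u w} → u ∈ comp A x y → Reach ((_∈ A) ∖ x) u w → Reach (_∈ comp A x y) u w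
    within u∈ (here _) = here u∈
    within u∈ (step _ e r) = step u∈ e (within (comp-step u∈ e (proj₁ (reach-source r)) (proj₂ (reach-source r))) r)
    inside : ∀ {w} → Reach ((_∈ A) ∖ x) y w → Reach (_∈ comp A x y) y w
    inside r = within (comp⁺ (here (reach-source r))) r

  comp-cover : ∀ {A x w} → IsConnected A → x ∈ A → w ∈ A → w ≢ x →
    ∃ λ z → z ∈ A × Adj G x z × w ∈ comp A x z
  comp-cover conn x∈A w∈A w≢x with first-step (conn x∈A w∈A) w≢x
  ... | z , e , r , _ = z , proj₁ (reach-source r) , e , comp⁺ r

  comp-children : ∀ {A x y w} → w ∈ comp A x y → w ≢ y →
    ∃ λ z → z ∈ A × Adj G y z × z ≢ x × w ∈ comp A y z
  comp-children w∈ w≢y with first-step (comp⁻ w∈) w≢y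
  ... | z , e , r , _ with reach-source r
  ...   | (z∈A , z≢x) , _ = z , z∈A , e , z≢x , comp⁺ (reach-map (λ ((a , _) , b) → a , b) r)

  module _ (acyclic : Acyclic G) where

    comp-neighbour : ∀ {A x y w} → Adj G x y → w ∈ comp A x y → Adj G x w → w ≡ y
    comp-neighbour e w∈ e′ = ≡.sym (unique-neighbour acyclic e e′ (reach-map proj₂ (comp⁻ w∈)))

    comp-disjoint : ∀ {A x y z w} → Adj G x y → Adj G x z → w ∈ comp A x y → w ∈ comp A x z → y ≡ z
    comp-disjoint ey ez w∈y w∈z = unique-neighbour acyclic ey ez
      (reach-map proj₂ (reach-trans (comp⁻ w∈y) (reach-sym (comp⁻ w∈z))))

    -- A walk from `z` that avoids `y` cannot meet `x`: otherwise `x` and `z` would be two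
    -- neighbours of `y` joined away from `y`.
    comp-nest : ∀ {A x y z} → y ∈ A → Adj G x y → Adj G y z → z ≢ x → comp A y z ⊆ comp A x y
    comp-nest {A} {x} {y} {z} y∈A xy yz z≢x {w} w∈ =
      comp⁺ (step (y∈A , adj⇒≢ (adj-sym xy)) yz (avoid (comp⁻ w∈)))
      where
      off : ∀ {u} → Reach ((_∈ A) ∖ y) z u → u ≢ x
      off r refl = z≢x (unique-neighbour acyclic yz (adj-sym xy) (reach-map proj₂ r))
      go : ∀ {u} → Reach ((_∈ A) ∖ y) z u → Reach ((_∈ A) ∖ y) u w → Reach ((_∈ A) ∖ x) u w
      go s (here (p , _)) = here (p , off s)
      go s (step (p , _) e r) = step (p , off s) e (go (reach-snoc s e (reach-source r)) r)
      avoid : Reach ((_∈ A) ∖ y) z w → Reach ((_∈ A) ∖ x) z w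
      avoid r = go (here (reach-source r)) r

-- Lists of bags in which a vertex occupies a block.

module _ {A : Set} where

  -- The segments may be empty, so `Contiguous` includes the case that `w` is in no bag. Splittings
  -- of the list, unlike conditions on indices, pass directly through concatenation and reversal.
  Starts Ends Contiguous : A → List (List A) → Set
  Starts w L = ∃₂ λ ys zs → L ≡ ys ++ zs × All (w ∈ₗ_) ys × All (w ∉ₗ_) zs
  Ends w L = ∃₂ λ xs ys → L ≡ xs ++ ys × All (w ∉ₗ_) xs × All (w ∈ₗ_) ys
  Contiguous w L = ∃₂ λ xs L′ → L ≡ xs ++ L′ × All (w ∉ₗ_) xs × Starts w L′

  absent⇒contiguous : ∀ {w L} → All (w ∉ₗ_) L → Contiguous w L
  absent⇒contiguous {L = L} no-w = L , [] , ≡.sym (List.++-identityʳ L) , no-w , [] , [] , refl , [] , []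

  starts⇒contiguous : ∀ {w L} → Starts w L → Contiguous w L
  starts⇒contiguous s = [] , _ , refl , [] , s

  present⇒starts : ∀ {w L} → All (w ∈ₗ_) L → Starts w L
  present⇒starts {L = L} all-w = L , [] , ≡.sym (List.++-identityʳ L) , all-w , []

  contiguous-++ˡ : ∀ {w L M} → All (w ∉ₗ_) L → Contiguous w M → Contiguous w (L ++ M)
  contiguous-++ˡ {L = L} no-w (xs , M′ , refl , no-xs , s) =
    L ++ xs , M′ , ≡.sym (List.++-assoc L xs M′) , All.++⁺ no-w no-xs , s

  contiguous-++ʳ : ∀ {w L M} → Contiguous w L → All (w ∉ₗ_) M → Contiguous w (L ++ M)
  contiguous-++ʳ {M = M} (xs , _ , refl , no-xs , ys , zs , refl , all-ys , no-zs) no-w =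
    xs , (ys ++ zs) ++ M , List.++-assoc xs (ys ++ zs) M , no-xs ,
    ys , zs ++ M , List.++-assoc ys zs M , all-ys , All.++⁺ no-zs no-w

  contiguous-++ : ∀ {w L M} → Ends w L → Starts w M → Contiguous w (L ++ M)
  contiguous-++ (xs , ys , refl , no-xs , all-ys) (ys′ , zs , refl , all-ys′ , no-zs) =
    xs , ys ++ (ys′ ++ zs) , List.++-assoc xs ys (ys′ ++ zs) , no-xs ,
    ys ++ ys′ , zs , ≡.sym (List.++-assoc ys ys′ zs) , All.++⁺ all-ys all-ys′ , no-zs

  ends-++ : ∀ {w L M} → Ends w L → All (w ∈ₗ_) M → Ends w (L ++ M)
  ends-++ {M = M} (xs , ys , refl , no-xs , all-ys) all-w =
    xs , ys ++ M , List.++-assoc xs ys M , no-xs , All.++⁺ all-ys all-w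

  all-reverse : ∀ {P : List A → Set} {L} → All P L → All P (reverse L)
  all-reverse = All.anti-mono Any.reverse⁻

  starts-reverse : ∀ {w L} → Ends w L → Starts w (reverse L)
  starts-reverse (xs , ys , refl , no-xs , all-ys) =
    reverse ys , reverse xs , List.reverse-++ xs ys , all-reverse all-ys , all-reverse no-xs

  contiguous-reverse : ∀ {w L} → Contiguous w L → Contiguous w (reverse L)
  contiguous-reverse (xs , _ , refl , no-xs , ys , zs , refl , all-ys , no-zs) =
    reverse zs , reverse ys ++ reverse xs ,
    ≡.trans (List.reverse-++ xs (ys ++ zs))
      (≡.trans (cong (_++ reverse xs) (List.reverse-++ ys zs)) (List.++-assoc (reverse zs) _ _)) ,
    all-reverse no-zs , reverse ys , reverse xs , refl , all-reverse all-ys , all-reverse no-xs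

  contiguous-map : ∀ {w} {f : List A → List A} {L} →
    (∀ {B} → w ∈ₗ B → w ∈ₗ f B) → (∀ {B} → w ∉ₗ B → w ∉ₗ f B) → Contiguous w L → Contiguous w (map f L)
  contiguous-map {f = f} on off (xs , _ , refl , no-xs , ys , zs , refl , all-ys , no-zs) =
    map f xs , map f (ys ++ zs) , List.map-++ f xs (ys ++ zs) , All.map⁺ (All.map off no-xs) ,
    map f ys , map f zs , List.map-++ f ys zs , All.map⁺ (All.map on all-ys) , All.map⁺ (All.map off no-zs)

-- The choice is read off from `f`, since obstructions and layouts arise from recursive calls and
-- not from a decision procedure.
search : ∀ {N} {Q X Y : Fin N → Set} → Decidable Q → (∀ z → Q z → X z ⊎ Y z) →
  (∃ λ z → Q z × X z) ⊎ (∀ z → Q z → Y z)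
search {zero} Q? f = inj₂ λ ()
search {suc N} Q? f with search (Q? ∘ fsuc) (f ∘ fsuc)
... | inj₁ (z , q , x) = inj₁ (fsuc z , q , x)
... | inj₂ ys with Q? fzero
...   | no ¬q = inj₂ λ { fzero q → contradiction q ¬q ; (fsuc z) q → ys z q }
...   | yes q with f fzero q
...     | inj₁ x = inj₁ (fzero , q , x)
...     | inj₂ y = inj₂ λ { fzero _ → y ; (fsuc z) q → ys z q }

-- Layouts and obstructions

module Layouts (G : Graph) where

  open Components G

  private
    V : Set
    V = Vtx

  open DecMembership (Fin._≟_ {n G}) using () renaming (_∈?_ to _∈ₗ?_)

  -- A path decomposition of the subgraph induced by `A`, of width at most m - 1. Bags are lists,
  -- and their length bounds the number of distinct vertices.
  record Layout (m : ℕ) (A : V → Set) : Set where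
    field
      bags       : List (List V)
      bound      : All (λ B → length B ≤ m) bags
      sound      : ∀ {w} → Any (w ∈ₗ_) bags → A w
      covers     : ∀ {w} → A w → Any (w ∈ₗ_) bags
      joins      : ∀ {u w} → A u → A w → Adj G u w → Any (λ B → u ∈ₗ B × w ∈ₗ B) bags
      contiguous : ∀ w → Contiguous w bags

  open Layout public

  layout-resp : ∀ {m A B} → (∀ {w} → A w → B w) → (∀ {w} → B w → A w) → Layout m A → Layout m B
  layout-resp to from D = record
    { bags = bags D ; bound = bound D ; sound = to ∘ sound D ; covers = covers D ∘ from
    ; joins = λ u w → joins D (from u) (from w) ; contiguous = contiguous D }

  absent : ∀ {m A} (D : Layout m A) {w} → ¬ A w → All (w ∉ₗ_) (bags D)
  absent D ¬A = All.¬Any⇒All¬ (bags D) (¬A ∘ sound D)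

  layout-reverse : ∀ {m A} → Layout m A → Layout m A
  layout-reverse D = record
    { bags = reverse (bags D) ; bound = all-reverse (bound D) ; sound = sound D ∘ Any.reverse⁻
    ; covers = Any.reverse⁺ ∘ covers D ; joins = λ u w e → Any.reverse⁺ (joins D u w e)
    ; contiguous = contiguous-reverse ∘ contiguous D }

  -- Shared vertices sit on both sides of the seam, so their blocks merge there; an edge between the
  -- two parts lies entirely in one of them.
  layout-++ : ∀ {m A B} (D : Layout m A) (E : Layout m B) →
    (∀ {w} → A w → B w → Ends w (bags D) × Starts w (bags E)) →
    (∀ {u w} → A u → B w → Adj G u w → A w ⊎ B u) →
    Layout m (λ w → A w ⊎ B w)
  layout-++ {m} {A} {B} D E shared separated = record
    { bags = bags D ++ bags E
    ; bound = All.++⁺ (bound D) (bound E)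
    ; sound = Sum.map (sound D) (sound E) ∘ Any.++⁻ (bags D)
    ; covers = [ Any.++⁺ˡ ∘ covers D , Any.++⁺ʳ (bags D) ∘ covers E ]′
    ; joins = joins′
    ; contiguous = contiguous′ }
    where
    joinD : ∀ {u w} → A u → A w → Adj G u w → Any (λ B → u ∈ₗ B × w ∈ₗ B) (bags D ++ bags E)
    joinD a b e = Any.++⁺ˡ (joins D a b e)
    joinE : ∀ {u w} → B u → B w → Adj G u w → Any (λ B → u ∈ₗ B × w ∈ₗ B) (bags D ++ bags E)
    joinE a b e = Any.++⁺ʳ (bags D) (joins E a b e)
    joins′ : ∀ {u w} → A u ⊎ B u → A w ⊎ B w → Adj G u w → Any (λ B → u ∈ₗ B × w ∈ₗ B) (bags D ++ bags E)
    joins′ (inj₁ a) (inj₁ b) e = joinD a b e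
    joins′ (inj₂ a) (inj₂ b) e = joinE a b e
    joins′ (inj₁ a) (inj₂ b) e with separated a b e
    ... | inj₁ b′ = joinD a b′ e
    ... | inj₂ a′ = joinE a′ b e
    joins′ (inj₂ a) (inj₁ b) e with separated b a (adj-sym e)
    ... | inj₁ a′ = joinD a′ b e
    ... | inj₂ b′ = joinE a b′ e
    contiguous′ : ∀ w → Contiguous w (bags D ++ bags E)
    contiguous′ w with Any.any? (w ∈ₗ?_) (bags D) | Any.any? (w ∈ₗ?_) (bags E)
    ... | no w∉D | _ = contiguous-++ˡ (All.¬Any⇒All¬ _ w∉D) (contiguous E w)
    ... | yes _ | no w∉E = contiguous-++ʳ (contiguous D w) (All.¬Any⇒All¬ _ w∉E)
    ... | yes w∈D | yes w∈E with shared (sound D w∈D) (sound E w∈E)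
    ...   | ends , starts = contiguous-++ ends starts

  layout-empty : ∀ {m A} → (∀ {w} → ¬ A w) → Layout m A
  layout-empty ¬A = record
    { bags = [] ; bound = [] ; sound = λ () ; covers = ⊥-elim ∘ ¬A
    ; joins = λ a _ _ → ⊥-elim (¬A a) ; contiguous = λ _ → absent⇒contiguous [] }

  layout-cone : ∀ {m A} y → Layout m A → ¬ A y →
    Σ (Layout (suc m) (λ w → w ≡ y ⊎ A w)) λ D → All (y ∈ₗ_) (bags D)
  layout-cone {m} {A} y D ¬Ay = record
    { bags = L
    ; bound = s≤s z≤n ∷ All.map⁺ (All.map s≤s (bound D))
    ; sound = sound′
    ; covers = λ { (inj₁ refl) → here (here refl) ; (inj₂ a) → there (Any.map⁺ (Any.map there (covers D a))) }
    ; joins = joins′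
    ; contiguous = contiguous′ } , all-y
    where
    L : List (List V)
    -- The extra bag holds `y` even when `D` has no bags.
    L = (y ∷ []) ∷ map (y ∷_) (bags D)
    all-y : All (y ∈ₗ_) L
    all-y = here refl ∷ All.map⁺ (All.universal (λ _ → here refl) (bags D))
    lift : ∀ {w} → w ≢ y → w ∈ₗ y ∷ [] → A w
    lift w≢y (here eq) = contradiction eq w≢y
    unlift : ∀ {w B} → w ≢ y → w ∈ₗ y ∷ B → w ∈ₗ B
    unlift w≢y (here eq) = contradiction eq w≢y
    unlift w≢y (there w∈) = w∈
    sound′ : ∀ {w} → Any (w ∈ₗ_) L → w ≡ y ⊎ A w
    sound′ {w} w∈ with w Fin.≟ y | w∈
    ... | yes w≡y | _ = inj₁ w≡y
    ... | no w≢y | here w∈y = inj₂ (lift w≢y w∈y)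
    ... | no w≢y | there w∈D = inj₂ (sound D (Any.map (unlift w≢y) (Any.map⁻ w∈D)))
    joins′ : ∀ {u w} → u ≡ y ⊎ A u → w ≡ y ⊎ A w → Adj G u w → Any (λ B → u ∈ₗ B × w ∈ₗ B) L
    joins′ (inj₁ refl) (inj₁ refl) e = contradiction refl (adj⇒≢ e)
    joins′ (inj₁ refl) (inj₂ b) e = there (Any.map⁺ (Any.map (λ w∈ → here refl , there w∈) (covers D b)))
    joins′ (inj₂ a) (inj₁ refl) e = there (Any.map⁺ (Any.map (λ u∈ → there u∈ , here refl) (covers D a)))
    joins′ (inj₂ a) (inj₂ b) e = there (Any.map⁺ (Any.map (λ (u∈ , w∈) → there u∈ , there w∈) (joins D a b e)))
    contiguous′ : ∀ w → Contiguous w L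
    contiguous′ w with w Fin.≟ y
    ... | yes refl = starts⇒contiguous (present⇒starts all-y)
    ... | no w≢y = contiguous-++ˡ {L = (y ∷ []) ∷ []} ((λ { (here eq) → w≢y eq }) ∷ [])
                     (contiguous-map there (λ w∉ → w∉ ∘ unlift w≢y) (contiguous D w))

  -- A layout open at its right end: `y` is in the last bag, so further bags around `y` can be
  -- appended.
  record Rooted (m : ℕ) (A : V → Set) (y : V) : Set where
    constructor rooted
    field
      layout : Layout m A
      root   : A y
      ends   : Ends y (bags layout)

  open Rooted public

  rooted-resp : ∀ {m A B y} → (∀ {w} → A w → B w) → (∀ {w} → B w → A w) → Rooted m A y → Rooted m B y
  rooted-resp to from R = rooted (layout-resp to from (layout R)) (to (root R)) (ends R)

  rooted-singleton : ∀ {m} y → Rooted (suc m) (_≡ y) y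
  rooted-singleton y with layout-cone y (layout-empty {A = λ _ → ⊥} id) id
  ... | D , all-y = rooted (layout-resp [ id , (λ ()) ]′ inj₁ D) refl ([] , _ , refl , [] , all-y)

  -- Every bag of the attached part receives `y`. This costs one in the bag size and keeps `y` at
  -- the end, so any number of components can be attached in a row.
  attach-component : ∀ {m A C y} → Rooted (suc m) A y → Layout m C → ¬ C y →
    (∀ {w} → A w → ¬ C w) → (∀ {u w} → A u → C w → Adj G u w → u ≡ y) →
    Rooted (suc m) (λ w → A w ⊎ C w) y
  attach-component {y = y} R E ¬Cy disjoint separated with layout-cone y E ¬Cy
  ... | E′ , all-y = rooted
    (layout-resp [ inj₁ , [ (λ { refl → inj₁ (root R) }) , inj₂ ]′ ]′ [ inj₁ , inj₂ ∘ inj₂ ]′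
      (layout-++ (layout R) E′
        (λ { a (inj₁ refl) → ends R , present⇒starts all-y ; a (inj₂ c) → contradiction c (disjoint a) })
        (λ { a (inj₁ refl) e → inj₁ (root R) ; a (inj₂ c) e → inj₂ (inj₁ (separated a c e)) })))
    (inj₁ (root R)) (ends-++ (ends R) all-y)

  layout-pair : ∀ {m} a y → 2 ≤ m → Layout m (λ w → w ≡ a ⊎ w ≡ y)
  layout-pair a y 2≤m = record
    { bags = B ∷ [] ; bound = 2≤m ∷ []
    ; sound = λ { (here w∈) → from w∈ } ; covers = here ∘ to
    ; joins = λ u w _ → here (to u , to w)
    ; contiguous = λ w → case w ∈ₗ? B of λ where
        (yes w∈) → starts⇒contiguous (present⇒starts (w∈ ∷ []))
        (no w∉) → absent⇒contiguous (w∉ ∷ []) }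
    where
    B : List V
    B = a ∷ y ∷ []
    to : ∀ {w} → w ≡ a ⊎ w ≡ y → w ∈ₗ B
    to (inj₁ refl) = here refl
    to (inj₂ refl) = there (here refl)
    from : ∀ {w} → w ∈ₗ B → w ≡ a ⊎ w ≡ y
    from (here eq) = inj₁ eq
    from (there (here eq)) = inj₂ eq

  -- The bag of `a` and `y` is appended; it carries the only possible edge from `A` to `y`.
  extend-root : ∀ {m A a y} → 2 ≤ m → Rooted m A a → ¬ A y → (∀ {u} → A u → Adj G u y → u ≡ a) →
    Rooted m (λ w → w ≡ y ⊎ A w) y
  extend-root {a = a} {y} 2≤m R ¬Ay separated = rooted
    (layout-resp [ inj₂ , [ (λ { refl → inj₂ (root R) }) , inj₁ ]′ ]′ [ inj₂ ∘ inj₂ , inj₁ ]′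
      (layout-++ (layout R) (layout-pair a y 2≤m)
        (λ { _ (inj₁ refl) → ends R , present⇒starts (here refl ∷ []) ; Ay (inj₂ refl) → contradiction Ay ¬Ay })
        (λ { _ (inj₁ refl) _ → inj₁ (root R) ; Au (inj₂ refl) e → inj₂ (inj₁ (separated Au e)) })))
    (inj₁ refl)
    (_ , _ , refl , absent (layout R) ¬Ay , there (here refl) ∷ [])

  -- One layout is reversed, so that the two ends containing `y` face each other.
  join-roots : ∀ {m A B y} → Rooted m A y → Rooted m B y → (∀ {w} → A w → B w → w ≡ y) →
    (∀ {u w} → A u → B w → Adj G u w → u ≡ y ⊎ w ≡ y) → Layout m (λ w → A w ⊎ B w)
  join-roots R S meet separated = layout-++ (layout R) (layout-reverse (layout S))
    (λ a b → case meet a b of λ { refl → ends R , starts-reverse (ends S) })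
    (λ a b e → case separated a b e of λ { (inj₁ refl) → inj₂ (root S) ; (inj₂ refl) → inj₁ (root R) })

  -- A certificate for pathwidth at least k.
  data Obstruction : ℕ → Subset (n G) → Set where
    edge : ∀ {D u w} → u ∈ D → w ∈ D → Adj G u w → Obstruction 1 D
    fork : ∀ {k D} v → v ∈ D → (r : Fin 3 → V) (E : Fin 3 → Subset (n G)) →
      (∀ i → Adj G v (r i)) → (∀ i → r i ∈ E i) → (∀ i → E i ⊆ D) → (∀ i → v ∉ E i) →
      (∀ i → IsConnected (E i)) → (∀ i j {w} → w ∈ E i → w ∈ E j → i ≡ j) →
      (∀ i → Obstruction k (E i)) → Obstruction (suc k) D

  -- Either an obstruction or a layout, one order higher.

  module _ (acyclic : Acyclic G) (k : ℕ)
    (dichotomy′ : ∀ A → IsConnected A → Obstruction (suc k) A ⊎ Layout (suc k) (_∈ A))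
    (A : Subset (n G)) (connected : IsConnected A) where

    private
      Result : Set
      Result = Obstruction (2 + k) A ⊎ Layout (2 + k) (_∈ A)

    module AtVertex (y : V) (y∈A : y ∈ A) where

      C : V → Subset (n G)
      C z = comp A y z

      Nbr : V → Set
      Nbr z = z ∈ A × Adj G y z

      nbr? : Decidable Nbr
      nbr? z = z ∈? A ×-dec adj? y z

      Hub : (V → Set) → V → Set
      Hub H w = w ≡ y ⊎ ∃ λ z → H z × w ∈ C z

      same-component : ∀ {z z′ u w} → Nbr z → Nbr z′ → u ∈ C z → w ∈ C z′ → Adj G u w → z ≡ z′
      same-component (_ , e) (_ , e′) u∈ w∈ uw =
        comp-disjoint acyclic e e′ (comp-step u∈ uw (comp-⊆ w∈) (comp-≢ w∈)) w∈

      attach : ∀ {m} {H : V → Set} {z} → (∀ {z′} → H z′ → Nbr z′) → Nbr z → ¬ H z → Layout m (_∈ C z) →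
        Rooted (suc m) (Hub H) y → Rooted (suc m) (Hub (λ z′ → H z′ ⊎ z′ ≡ z)) y
      attach {H = H} {z} H⊆ nz ¬Hz D R = rooted-resp
        [ [ inj₁ , (λ (z′ , h , w∈) → inj₂ (z′ , inj₁ h , w∈)) ]′ , (λ w∈ → inj₂ (z , inj₂ refl , w∈)) ]′
        [ inj₁ ∘ inj₁ , (λ { (z′ , inj₁ h , w∈) → inj₁ (inj₂ (z′ , h , w∈)) ; (z′ , inj₂ refl , w∈) → inj₂ w∈ }) ]′
        (attach-component R D (λ y∈ → comp-≢ y∈ refl) disjoint separated)
        where
        disjoint : ∀ {w} → Hub H w → w ∉ C z
        disjoint (inj₁ refl) w∈ = comp-≢ w∈ refl
        disjoint (inj₂ (z′ , h , w∈z′)) w∈z =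
          ¬Hz (subst H (comp-disjoint acyclic (proj₂ (H⊆ h)) (proj₂ nz) w∈z′ w∈z) h)
        separated : ∀ {u w} → Hub H u → w ∈ C z → Adj G u w → u ≡ y
        separated (inj₁ eq) _ _ = eq
        separated (inj₂ (z′ , h , u∈)) w∈ e = ⊥-elim (¬Hz (subst H (same-component (H⊆ h) nz u∈ w∈ e) h))

      attach-list : ∀ {m} {H Q : V → Set} → (∀ {z} → H z → Nbr z) → Decidable Q → (∀ {z} → Q z → Nbr z × ¬ H z) →
        (∀ z → Q z → Layout m (_∈ C z)) → Rooted (suc m) (Hub H) y → ∀ zs →
        Rooted (suc m) (Hub (λ z → H z ⊎ (Q z × z ∈ₗ zs))) y
      attach-list H⊆ Q? Q⊆ lay R [] = rooted-resp
        [ inj₁ , (λ (z , h , w∈) → inj₂ (z , inj₁ h , w∈)) ]′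
        [ inj₁ , (λ { (z , inj₁ h , w∈) → inj₂ (z , h , w∈) ; (_ , inj₂ (_ , ()) , _) }) ]′ R
      -- A neighbour that recurs later in the list is skipped, for its component is attached
      -- already.
      attach-list {H = H} {Q} H⊆ Q? Q⊆ lay R (z ∷ zs) with attach-list H⊆ Q? Q⊆ lay R zs | Q? z ×-dec ¬? (z ∈ₗ? zs)
      ... | R′ | yes (q , z∉) = rooted-resp
        [ inj₁ , (λ { (z′ , inj₁ (inj₁ h) , w∈) → inj₂ (z′ , inj₁ h , w∈)
                    ; (z′ , inj₁ (inj₂ (q′ , z′∈)) , w∈) → inj₂ (z′ , inj₂ (q′ , there z′∈) , w∈)
                    ; (z′ , inj₂ refl , w∈) → inj₂ (z′ , inj₂ (q , here refl) , w∈) }) ]′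
        [ inj₁ , (λ { (z′ , inj₁ h , w∈) → inj₂ (z′ , inj₁ (inj₁ h) , w∈)
                    ; (z′ , inj₂ (q′ , here refl) , w∈) → inj₂ (z′ , inj₂ refl , w∈)
                    ; (z′ , inj₂ (q′ , there z′∈) , w∈) → inj₂ (z′ , inj₁ (inj₂ (q′ , z′∈)) , w∈) }) ]′
        (attach [ H⊆ , (λ (q′ , _) → proj₁ (Q⊆ q′)) ]′ (proj₁ (Q⊆ q))
          [ proj₂ (Q⊆ q) , (λ (_ , z∈) → z∉ z∈) ]′ (lay z q) R′)
      ... | R′ | no ¬new = rooted-resp
        [ inj₁ , (λ { (z′ , inj₁ h , w∈) → inj₂ (z′ , inj₁ h , w∈)
                    ; (z′ , inj₂ (q′ , z′∈) , w∈) → inj₂ (z′ , inj₂ (q′ , there z′∈) , w∈) }) ]′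
        [ inj₁ , (λ { (z′ , inj₁ h , w∈) → inj₂ (z′ , inj₁ h , w∈)
                    ; (z′ , inj₂ (q′ , there z′∈) , w∈) → inj₂ (z′ , inj₂ (q′ , z′∈) , w∈)
                    ; (z′ , inj₂ (q′ , here refl) , w∈) → inj₂ (z′ , inj₂ (q′ , old q′) , w∈) }) ]′ R′
        where
        old : Q z → z ∈ₗ zs
        old q with z ∈ₗ? zs
        ... | yes z∈ = z∈
        ... | no z∉ = ⊥-elim (¬new (q , z∉))

      attach-all : ∀ {m} {H Q : V → Set} → (∀ {z} → H z → Nbr z) → Decidable Q → (∀ {z} → Q z → Nbr z × ¬ H z) →
        (∀ z → Q z → Layout m (_∈ C z)) → Rooted (suc m) (Hub H) y → Rooted (suc m) (Hub (λ z → H z ⊎ Q z)) y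
      attach-all H⊆ Q? Q⊆ lay R = rooted-resp
        [ inj₁ , (λ { (z , inj₁ h , w∈) → inj₂ (z , inj₁ h , w∈) ; (z , inj₂ (q , _) , w∈) → inj₂ (z , inj₂ q , w∈) }) ]′
        [ inj₁ , (λ { (z , inj₁ h , w∈) → inj₂ (z , inj₁ h , w∈) ; (z , inj₂ q , w∈) → inj₂ (z , inj₂ (q , ∈-allFin z) , w∈) }) ]′
        (attach-list H⊆ Q? Q⊆ lay R (allFin _))

      hub-extend : ∀ {m a} → Nbr a → Rooted (2 + m) (_∈ C a) a → Rooted (2 + m) (Hub (_≡ a)) y
      hub-extend {a = a} (_ , e) R = rooted-resp
        [ inj₁ , (λ w∈ → inj₂ (a , refl , w∈)) ]′ [ inj₁ , (λ { (_ , refl , w∈) → inj₂ w∈ }) ]′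
        (extend-root (s≤s (s≤s z≤n)) R (λ y∈ → comp-≢ y∈ refl)
          (λ u∈ uy → comp-neighbour acyclic e u∈ (adj-sym uy)))

      three-heavy : ∀ {a b c} → Nbr a → Nbr b → Nbr c → a ≢ b → c ≢ a → c ≢ b →
        Obstruction (suc k) (C a) → Obstruction (suc k) (C b) → Obstruction (suc k) (C c) →
        Obstruction (2 + k) A
      three-heavy {a} {b} {c} na nb nc a≢b c≢a c≢b oa ob oc = fork y y∈A r (C ∘ r)
        (proj₂ ∘ nbr) (λ i → root∈comp (proj₁ (nbr i)) (proj₂ (nbr i))) (λ i → comp-⊆)
        (λ i y∈ → comp-≢ y∈ refl) (λ i → comp-connected)
        (λ i j w∈i w∈j → r-injective i j (comp-disjoint acyclic (proj₂ (nbr i)) (proj₂ (nbr j)) w∈i w∈j))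
        λ { fzero → oa ; (fsuc fzero) → ob ; (fsuc (fsuc fzero)) → oc }
        where
        r : Fin 3 → V
        r fzero = a
        r (fsuc fzero) = b
        r (fsuc (fsuc fzero)) = c
        nbr : ∀ i → Nbr (r i)
        nbr fzero = na
        nbr (fsuc fzero) = nb
        nbr (fsuc (fsuc fzero)) = nc
        r-injective : ∀ i j → r i ≡ r j → i ≡ j
        r-injective fzero fzero _ = refl
        r-injective fzero (fsuc fzero) eq = contradiction eq a≢b
        r-injective fzero (fsuc (fsuc fzero)) eq = contradiction (≡.sym eq) c≢a
        r-injective (fsuc fzero) fzero eq = contradiction (≡.sym eq) a≢b
        r-injective (fsuc fzero) (fsuc fzero) _ = refl
        r-injective (fsuc fzero) (fsuc (fsuc fzero)) eq = contradiction (≡.sym eq) c≢b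
        r-injective (fsuc (fsuc fzero)) fzero eq = contradiction eq c≢a
        r-injective (fsuc (fsuc fzero)) (fsuc fzero) eq = contradiction eq c≢b
        r-injective (fsuc (fsuc fzero)) (fsuc (fsuc fzero)) _ = refl

      -- Both rooted layouts are led to `y` and joined there. The other components at `y` are light
      -- and are attached to the first one before the joining.
      two-heavy : ∀ {a b} → Nbr a → Nbr b → b ≢ a →
        Rooted (2 + k) (_∈ C a) a → Rooted (2 + k) (_∈ C b) b →
        (∀ z → Nbr z × z ≢ a × z ≢ b → Layout (suc k) (_∈ C z)) → Layout (2 + k) (_∈ A)
      two-heavy {a} {b} na nb b≢a ra rb lay = layout-resp
        [ inA , inA ]′ split
        (join-roots (attach-all (λ { refl → na }) (λ z → nbr? z ×-dec ¬? (z Fin.≟ a) ×-dec ¬? (z Fin.≟ b))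
                      (λ (nz , z≢a , _) → nz , z≢a) lay (hub-extend na ra))
                    (hub-extend nb rb) meet separated)
        where
        H : V → Set
        H z = z ≡ a ⊎ (Nbr z × z ≢ a × z ≢ b)
        H⊆ : ∀ {z} → H z → Nbr z × z ≢ b
        H⊆ (inj₁ refl) = na , (b≢a ∘ ≡.sym)
        H⊆ (inj₂ (nz , _ , z≢b)) = nz , z≢b
        inA : ∀ {K : V → Set} {w} → Hub K w → w ∈ A
        inA (inj₁ refl) = y∈A
        inA (inj₂ (_ , _ , w∈)) = comp-⊆ w∈
        split : ∀ {w} → w ∈ A → Hub H w ⊎ Hub (_≡ b) w
        split {w} w∈A with w Fin.≟ y
        ... | yes eq = inj₁ (inj₁ eq)
        ... | no w≢y with comp-cover connected y∈A w∈A w≢y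
        ...   | z , z∈A , e , w∈ with z Fin.≟ a | z Fin.≟ b
        ...     | yes z≡a | _ = inj₁ (inj₂ (z , inj₁ z≡a , w∈))
        ...     | no z≢a | no z≢b = inj₁ (inj₂ (z , inj₂ ((z∈A , e) , z≢a , z≢b) , w∈))
        ...     | no _ | yes z≡b = inj₂ (inj₂ (z , z≡b , w∈))
        meet : ∀ {w} → Hub H w → Hub (_≡ b) w → w ≡ y
        meet (inj₁ eq) _ = eq
        meet (inj₂ _) (inj₁ eq) = eq
        meet (inj₂ (z , h , w∈z)) (inj₂ (_ , refl , w∈b)) =
          contradiction (comp-disjoint acyclic (proj₂ (proj₁ (H⊆ h))) (proj₂ nb) w∈z w∈b) (proj₂ (H⊆ h))
        separated : ∀ {u w} → Hub H u → Hub (_≡ b) w → Adj G u w → u ≡ y ⊎ w ≡ y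
        separated (inj₁ eq) _ _ = inj₁ eq
        separated (inj₂ _) (inj₁ eq) _ = inj₂ eq
        separated (inj₂ (z , h , u∈)) (inj₂ (_ , refl , w∈)) e =
          contradiction (same-component (proj₁ (H⊆ h)) nb u∈ w∈ e) (proj₂ (H⊆ h))

      -- `Q` selects the directions leading on from `y`. If none of them is heavy, the layout starts
      -- at `y`; if one is, the layout comes from there and moves on to `y`; if two are, all of `A`
      -- is settled.
      at-vertex : ∀ {Q : V → Set} → Decidable Q →
        (∀ z → Nbr z → Q z → Result ⊎ Rooted (2 + k) (_∈ C z) z) →
        Result ⊎ Rooted (2 + k) (Hub (λ z → Nbr z × Q z)) y
      at-vertex {Q} Q? recurse = first
        where
        Heavy Light : V → Set
        Heavy z = Result ⊎ (Obstruction (suc k) (C z) × Rooted (2 + k) (_∈ C z) z)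
        Light z = Layout (suc k) (_∈ C z)
        weigh : ∀ z → Nbr z × Q z → Heavy z ⊎ Light z
        weigh z (nz , q) with dichotomy′ (C z) comp-connected
        ... | inj₂ light = inj₂ light
        ... | inj₁ o = inj₁ (Sum.map₂ (o ,_) (recurse z nz q))
        first : Result ⊎ Rooted (2 + k) (Hub (λ z → Nbr z × Q z)) y
        first with search (λ z → nbr? z ×-dec Q? z) weigh
        ... | inj₂ lights = inj₂ (rooted-resp
                [ inj₁ , (λ { (_ , inj₁ () , _) ; (z , inj₂ q , w∈) → inj₂ (z , q , w∈) }) ]′
                [ inj₁ , (λ { (z , q , w∈) → inj₂ (z , inj₂ q , w∈) }) ]′
                (attach-all {H = λ _ → ⊥} (λ ()) (λ z → nbr? z ×-dec Q? z) (λ q → proj₁ q , id) lights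
                  (rooted-resp inj₁ [ id , (λ ()) ]′ (rooted-singleton y))))
        ... | inj₁ (_ , _ , inj₁ result) = inj₁ result
        ... | inj₁ (a , (na , qa) , inj₂ (oa , ra))
              with search (λ z → (nbr? z ×-dec Q? z) ×-dec ¬? (z Fin.≟ a)) (λ z (nq , _) → weigh z nq)
        ...   | inj₂ lights = inj₂ (rooted-resp
                [ inj₁ , (λ { (z , inj₁ refl , w∈) → inj₂ (z , (na , qa) , w∈) ; (z , inj₂ (q , _) , w∈) → inj₂ (z , q , w∈) }) ]′
                [ inj₁ , (λ { (z , q , w∈) → inj₂ (z , (case z Fin.≟ a of λ { (yes eq) → inj₁ eq ; (no z≢a) → inj₂ (q , z≢a) }) , w∈) }) ]′
                (attach-all (λ { refl → na }) (λ z → (nbr? z ×-dec Q? z) ×-dec ¬? (z Fin.≟ a))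
                  (λ ((nz , _) , z≢a) → nz , z≢a) lights (hub-extend na ra)))
        ...   | inj₁ (_ , _ , inj₁ result) = inj₁ result
        ...   | inj₁ (b , ((nb , _) , b≢a) , inj₂ (ob , rb))
                -- All neighbours of `y` are tried here, also those outside `Q`: a third heavy
                -- component gives an obstruction, and without one the whole of `A` can be laid out.
                with search (λ z → nbr? z ×-dec ¬? (z Fin.≟ a) ×-dec ¬? (z Fin.≟ b))
                       (λ z _ → dichotomy′ (C z) comp-connected)
        ...     | inj₁ (c , (nc , c≢a , c≢b) , oc) =
                  inj₁ (inj₁ (three-heavy na nb nc (b≢a ∘ ≡.sym) c≢a c≢b oa ob oc))
        ...     | inj₂ lights = inj₁ (inj₂ (two-heavy na nb b≢a ra rb lights))

    open AtVertex

    -- Either A is settled, or the branch at y is laid out along a path ending at y with light components attached.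
    below : ∀ {x y} → Acc _⊂_ (comp A x y) → x ∈ A → y ∈ A → Adj G x y →
      Result ⊎ Rooted (2 + k) (_∈ comp A x y) y
    below {x} {y} (acc rec) x∈A y∈A xy = Sum.map₂
      (rooted-resp
        [ (λ { refl → root∈comp y∈A xy }) , (λ { (z , ((_ , yz) , z≢x) , w∈) → comp-nest acyclic y∈A xy yz z≢x w∈ }) ]′
        split)
      (at-vertex y y∈A (λ z → ¬? (z Fin.≟ x))
        (λ z (z∈A , yz) z≢x → below
          (rec (comp-nest acyclic y∈A xy yz z≢x , y , root∈comp y∈A xy , λ y∈ → comp-≢ y∈ refl)) y∈A z∈A yz))
      where
      split : ∀ {w} → w ∈ comp A x y → Hub y y∈A (λ z → Nbr y y∈A z × z ≢ x) w
      split {w} w∈ with w Fin.≟ y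
      ... | yes eq = inj₁ eq
      ... | no w≢y with comp-children w∈ w≢y
      ...   | z , z∈A , e , z≢x , w∈z = inj₂ (z , ((z∈A , e) , z≢x) , w∈z)

    dichotomy-step : Result
    dichotomy-step with nonempty? A
    ... | no empty = inj₂ (layout-empty λ w∈ → empty (_ , w∈))
    -- The search starts at an arbitrary vertex with no direction excluded; `y ∈ A` stands in for
    -- the predicate that always holds.
    ... | yes (y , y∈A) with at-vertex y y∈A {Q = λ _ → y ∈ A} (λ _ → yes y∈A)
                               (λ z (z∈A , yz) _ → below (⊂-wellFounded _) y∈A z∈A yz)
    ...   | inj₁ result = result
    ...   | inj₂ R = inj₂ (layout-resp [ (λ { refl → y∈A }) , (λ { (_ , _ , w∈) → comp-⊆ w∈ }) ]′ split (layout R))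
      where
      split : ∀ {w} → w ∈ A → Hub y y∈A (λ z → Nbr y y∈A z × y ∈ A) w
      split {w} w∈ with w Fin.≟ y
      ... | yes eq = inj₁ eq
      ... | no w≢y with comp-cover connected y∈A w∈ w≢y
      ...   | z , z∈A , e , w∈z = inj₂ (z , ((z∈A , e) , y∈A) , w∈z)

  -- The alternatives certify pathwidth at least k + 1 and at most k. The induction is on `k`, since
  -- components are weighed by the dichotomy one order lower.
  dichotomy : Acyclic G → ∀ k A → IsConnected A → Obstruction (suc k) A ⊎ Layout (suc k) (_∈ A)
  dichotomy acyclic (suc k) A connected = dichotomy-step acyclic k (dichotomy acyclic k) A connected
  dichotomy acyclic zero A connected
    with Fin.any? (λ u → Fin.any? (λ w → u ∈? A ×-dec w ∈? A ×-dec adj? u w))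
  ... | yes (u , w , u∈ , w∈ , e) = inj₁ (edge u∈ w∈ e)
  ... | no no-edge with nonempty? A
  ...   | no empty = inj₂ (layout-empty λ w∈ → empty (_ , w∈))
  ...   | yes (y , y∈A) = inj₂ (layout-resp (λ { refl → y∈A }) only (layout (rooted-singleton y)))
    where
    only : ∀ {w} → w ∈ A → w ≡ y
    only w∈ with connected y∈A w∈
    ... | here _ = refl
    ... | step _ e r = ⊥-elim (no-edge (_ , _ , y∈A , reach-source r , e))

-- Bags as subsets, maxima and positions in a list.

module _ {N : ℕ} where

  fromList : List (Fin N) → Subset N
  fromList = foldr (λ x p → ⁅ x ⁆ ∪ p) ∅

  fromList⁺ : ∀ {w B} → w ∈ₗ B → w ∈ fromList B
  fromList⁺ (here refl) = x∈p∪q⁺ (inj₁ (x∈⁅x⁆ _))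
  fromList⁺ (there w∈) = x∈p∪q⁺ (inj₂ (fromList⁺ w∈))

  fromList⁻ : ∀ {w} B → w ∈ fromList B → w ∈ₗ B
  fromList⁻ [] w∈ = contradiction w∈ ∉⊥
  fromList⁻ (x ∷ B) w∈ with x∈p∪q⁻ ⁅ x ⁆ (fromList B) w∈
  ... | inj₁ w∈x = here (x∈⁅y⁆⇒x≡y x w∈x)
  ... | inj₂ w∈B = there (fromList⁻ B w∈B)

∣⁅x⁆∪p∣≤1+∣p∣ : ∀ {N} x (p : Subset N) → ∣ ⁅ x ⁆ ∪ p ∣ ≤ suc ∣ p ∣
∣⁅x⁆∪p∣≤1+∣p∣ fzero (b ∷ p) = s≤s (ℕ.≤-trans (ℕ.≤-reflexive (cong ∣_∣ (∪-identityˡ p))) (∣p∣≤∣x∷p∣ b p))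
∣⁅x⁆∪p∣≤1+∣p∣ (fsuc x) (true ∷ p) = s≤s (∣⁅x⁆∪p∣≤1+∣p∣ x p)
∣⁅x⁆∪p∣≤1+∣p∣ (fsuc x) (false ∷ p) = ∣⁅x⁆∪p∣≤1+∣p∣ x p

∣fromList∣≤length : ∀ {N} (B : List (Fin N)) → ∣ fromList B ∣ ≤ length B
∣fromList∣≤length {N} [] = ℕ.≤-reflexive (∣⊥∣≡0 N)
∣fromList∣≤length (x ∷ B) = ℕ.≤-trans (∣⁅x⁆∪p∣≤1+∣p∣ x (fromList B)) (s≤s (∣fromList∣≤length B))

0<∣p∣⇒nonempty : ∀ {N} (p : Subset N) → 0 < ∣ p ∣ → Nonempty p
0<∣p∣⇒nonempty {N} p 0<p with nonempty? p
... | yes ne = ne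
... | no empty = contradiction (ℕ.≤-trans 0<p (ℕ.≤-reflexive (≡.trans (cong ∣_∣ (Empty-unique empty)) (∣⊥∣≡0 N)))) λ ()

maxFin-lub : ∀ {N m} (f : Fin N → ℕ) → (∀ i → f i ≤ m) → maxFin f ≤ m
maxFin-lub {zero} f le = z≤n
maxFin-lub {suc N} f le = ℕ.⊔-lub (le fzero) (maxFin-lub (f ∘ fsuc) (le ∘ fsuc))

≤-maxFin : ∀ {N} (f : Fin N → ℕ) i → f i ≤ maxFin f
≤-maxFin f fzero = ℕ.m≤m⊔n _ _
≤-maxFin f (fsuc i) = ℕ.≤-trans (≤-maxFin (f ∘ fsuc) i) (ℕ.m≤n⊔m _ _)

median : ∀ {N} (f : Fin 3 → Fin N) →
  ∃₂ λ a l → ∃ λ c → a ≢ l × c ≢ l × f a ≤ᶠ f l × f l ≤ᶠ f c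
median f with Fin.≤-total (f fzero) (f (fsuc fzero)) | Fin.≤-total (f (fsuc fzero)) (f (fsuc (fsuc fzero)))
            | Fin.≤-total (f fzero) (f (fsuc (fsuc fzero)))
... | inj₁ p | inj₁ q | _ = fzero , fsuc fzero , fsuc (fsuc fzero) , (λ ()) , (λ ()) , p , q
... | inj₂ p | inj₂ q | _ = fsuc (fsuc fzero) , fsuc fzero , fzero , (λ ()) , (λ ()) , q , p
... | inj₁ p | inj₂ q | inj₁ r = fzero , fsuc (fsuc fzero) , fsuc fzero , (λ ()) , (λ ()) , r , q
... | inj₁ p | inj₂ q | inj₂ r = fsuc (fsuc fzero) , fzero , fsuc fzero , (λ ()) , (λ ()) , r , p
... | inj₂ p | inj₁ q | inj₁ r = fsuc fzero , fzero , fsuc (fsuc fzero) , (λ ()) , (λ ()) , p , r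
... | inj₂ p | inj₁ q | inj₂ r = fsuc fzero , fsuc (fsuc fzero) , fzero , (λ ()) , (λ ()) , q , r

starts-downward : ∀ {A : Set} {w : A} {L} → Starts w L → ∀ i j → i ≤ᶠ j → w ∈ₗ lookup L j → w ∈ₗ lookup L i
starts-downward ([] , zs , refl , _ , no-w) i j _ w∈ = contradiction (lose (∈-lookup j) w∈) (All.All¬⇒¬Any no-w)
starts-downward (_ ∷ ys , zs , refl , w∈₀ ∷ all-w , no-w) fzero j _ _ = w∈₀
starts-downward (_ ∷ ys , zs , refl , w∈₀ ∷ all-w , no-w) (fsuc i) (fsuc j) (s≤s i≤j) w∈ =
  starts-downward (ys , zs , refl , all-w , no-w) i j i≤j w∈

contiguous-between : ∀ {A : Set} {w : A} {L} → Contiguous w L → ∀ i j l → i ≤ᶠ j → j ≤ᶠ l →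
  w ∈ₗ lookup L i → w ∈ₗ lookup L l → w ∈ₗ lookup L j
contiguous-between ([] , L , refl , _ , s) i j l _ j≤l _ w∈ = starts-downward s j l j≤l w∈
contiguous-between (_ ∷ xs , L , refl , w∉ ∷ no-w , s) fzero j l _ _ w∈ _ = contradiction w∈ w∉
contiguous-between (_ ∷ xs , L , refl , _ ∷ no-w , s) (fsuc i) (fsuc j) (fsuc l) (s≤s i≤j) (s≤s j≤l) w∈i w∈l =
  contiguous-between (xs , L , refl , no-w , s) i j l i≤j j≤l w∈i w∈l

-- Layouts and obstructions as bounds on the pathwidth.

module Pathwidth (G : Graph) where

  open Components G
  open Layouts G

  layout⇒decomposition : ∀ {m} → Layout m (_∈ ⊤) → Σ (PathDecomposition G) λ D → ∀ i → ∣ bag D i ∣ ≤ m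
  layout⇒decomposition L = record
    { len = length (bags L)
    ; bag = fromList ∘ lookup (bags L)
    ; cover = λ v → Any.index (covers L (∈⊤ {x = v})) , fromList⁺ (Any.lookup-index (covers L (∈⊤ {x = v})))
    ; edges = λ u v e → let p = joins L ∈⊤ ∈⊤ e in
        Any.index p , fromList⁺ (proj₁ (Any.lookup-index p)) , fromList⁺ (proj₂ (Any.lookup-index p))
    ; consecutive = λ v i j l i≤j j≤l v∈i v∈l →
        fromList⁺ (contiguous-between (contiguous L v) i j l i≤j j≤l (fromList⁻ _ v∈i) (fromList⁻ _ v∈l))
    } , λ i → ℕ.≤-trans (∣fromList∣≤length (lookup (bags L) i)) (All.lookup (bound L) (∈-lookup i))

  module _ (D : PathDecomposition G) where

    -- The bags met by a connected set form an interval.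
    crossing : ∀ {P a c i j l} → Reach P a c → i ≤ᶠ l → l ≤ᶠ j → a ∈ bag D i → c ∈ bag D j →
      ∃ λ w → P w × w ∈ bag D l
    crossing {a = a} {i = i} {j} {l} (here p) i≤l l≤j a∈i a∈j = a , p , consecutive D a i l j i≤l l≤j a∈i a∈j
    crossing {a = a} {i = i} {j} {l} (step {b = b} p e r) i≤l l≤j a∈i c∈j with edges D a b e
    ... | m , a∈m , b∈m with Fin.≤-total l m
    ...   | inj₁ l≤m = a , p , consecutive D a i l m i≤l l≤m a∈i a∈m
    ...   | inj₂ m≤l = crossing r m≤l l≤j b∈m c∈j

    -- The induction counts inside `S`: the middle bag is large in `E l` already, and `link`, which
    -- runs in `S` outside `E l`, crosses it in one more vertex.
    obstruction⇒large-bag : ∀ {k S} → Obstruction k S → ∃ λ i → suc k ≤ ∣ bag D i ∩ S ∣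
    obstruction⇒large-bag (edge {S} {u} {w} u∈S w∈S e) with edges D u w e
    ... | i , u∈i , w∈i = i , subst (_< ∣ bag D i ∩ S ∣) (∣⁅x⁆∣≡1 u)
      (p⊂q⇒∣p∣<∣q∣ ((λ x∈ → subst (_∈ bag D i ∩ S) (≡.sym (x∈⁅y⁆⇒x≡y u x∈)) (x∈p∩q⁺ (u∈i , u∈S))) ,
        w , x∈p∩q⁺ (w∈i , w∈S) , λ w∈u → adj⇒≢ e (≡.sym (x∈⁅y⁆⇒x≡y u w∈u))))
    obstruction⇒large-bag (fork {k} {S} v v∈S r E vr r∈E E⊆S v∉E conn disjoint obs)
      with median (λ i → proj₁ (obstruction⇒large-bag (obs i)))
    ... | a , l , c , a≢l , c≢l , a≤l , l≤c = m , ℕ.≤-trans (s≤s (large l)) (p⊂q⇒∣p∣<∣q∣ strict)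
      where
      index : Fin 3 → Fin (len D)
      index i = proj₁ (obstruction⇒large-bag (obs i))
      large : ∀ i → suc k ≤ ∣ bag D (index i) ∩ E i ∣
      large i = proj₂ (obstruction⇒large-bag (obs i))
      m : Fin (len D)
      m = index l
      meets : ∀ i → ∃ λ w → w ∈ bag D (index i) × w ∈ E i
      meets i with 0<∣p∣⇒nonempty _ (ℕ.≤-trans (s≤s z≤n) (large i))
      ... | w , w∈ = w , x∈p∩q⁻ _ _ w∈
      Outside : Vtx → Set
      Outside w = w ∈ S × w ∉ E l
      outside : ∀ {i w} → i ≢ l → w ∈ E i → Outside w
      outside {i} i≢l w∈ = E⊆S i w∈ , i≢l ∘ disjoint i l w∈
      link : Reach Outside (proj₁ (meets a)) (proj₁ (meets c))
      link = reach-trans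
        (reach-snoc (reach-map (outside a≢l) (conn a (proj₂ (proj₂ (meets a))) (r∈E a))) (adj-sym (vr a)) (v∈S , v∉E l))
        (step (v∈S , v∉E l) (vr c) (reach-map (outside c≢l) (conn c (r∈E c) (proj₂ (proj₂ (meets c))))))
      strict : bag D m ∩ E l ⊂ bag D m ∩ S
      strict with crossing link a≤l l≤c (proj₁ (proj₂ (meets a))) (proj₁ (proj₂ (meets c)))
      ... | w , (w∈S , w∉E) , w∈m =
        (λ x∈ → let x∈m , x∈E = x∈p∩q⁻ (bag D m) (E l) x∈ in x∈p∩q⁺ (x∈m , E⊆S l x∈E)) ,
        w , x∈p∩q⁺ (w∈m , w∈S) , w∉E ∘ proj₂ ∘ x∈p∩q⁻ (bag D m) (E l)

    obstruction≤width : ∀ {k S} → Obstruction k S → k ≤ width D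
    obstruction≤width {k} {S} o with obstruction⇒large-bag o
    ... | i , large = ℕ.∸-monoˡ-≤ 1
      (ℕ.≤-trans large (ℕ.≤-trans (∣p∩q∣≤∣p∣ (bag D i) S) (≤-maxFin (λ j → ∣ bag D j ∣) i)))

-- The evader

module Lions (G : Graph) where

  open Components G
  open Layouts G using (Obstruction; edge; fork)

  Config : ℕ → Set
  Config j = Fin j → Vtx

  Move : ∀ {j} → Config j → Config j → Set
  Move p q = ∀ i → q i ≡ p i ⊎ Adj G (p i) (q i)

  Free : ∀ {j} → Config j → Vtx → Set
  Free p x = ∀ i → p i ≢ x

  infixr 5 _∷_ _⟫_
  data Run {j} : Config j → Config j → Set where
    []  : ∀ {p} → Run p p
    _∷_ : ∀ {p q r} → Move p q → Run q r → Run p r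

  _⟫_ : ∀ {j} {p q r : Config j} → Run p q → Run q r → Run p r
  [] ⟫ S = S
  (m ∷ R) ⟫ S = m ∷ (R ⟫ S)

  run-length : ∀ {j} {p q : Config j} → Run p q → ℕ
  run-length [] = 0
  run-length (_ ∷ R) = suc (run-length R)

  data Along {j} (Q : Config j → Set) : {p q : Config j} → Run p q → Set where
    []  : ∀ {p} → Q p → Along Q ([] {p = p})
    _∷_ : ∀ {p q r} {m : Move p q} {R : Run q r} → Q p → Along Q R → Along Q (m ∷ R)

  along-head : ∀ {j Q} {p q : Config j} {R : Run p q} → Along Q R → Q p
  along-head ([] h) = h
  along-head (h ∷ _) = h

  -- A lion crossing from x to y need not be excluded: it would be at x together with the evader.
  Slips : ∀ {j} → Config j → Config j → Vtx → Vtx → Set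
  Slips p q x y = x ≡ y ⊎ (Adj G x y × (∀ i → p i ≡ y → q i ≢ x))

  data Evades (D : Vtx → Set) {j} : {p q : Config j} → Run p q → Vtx → Vtx → Set where
    stop : ∀ {p x} → D x → Free p x → Evades D ([] {p = p}) x x
    go   : ∀ {p q r x y z} {m : Move p q} {R : Run q r} → D x → Free p x → Slips p q x y → Evades D R y z → Evades D (m ∷ R) x z

  module _ {D : Vtx → Set} {j : ℕ} where

    evades-map : ∀ {D′ : Vtx → Set} {p q : Config j} {R : Run p q} {x y} →
      (∀ {w} → D w → D′ w) → Evades D R x y → Evades D′ R x y
    evades-map f (stop d fr) = stop (f d) fr
    evades-map f (go d fr s ev) = go (f d) fr s (evades-map f ev)

    evades-source : ∀ {p q : Config j} {R : Run p q} {x y} → Evades D R x y → D x × Free p x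
    evades-source (stop d fr) = d , fr
    evades-source (go d fr _ _) = d , fr

    evades-target : ∀ {p q : Config j} {R : Run p q} {x y} → Evades D R x y → D y × Free q y
    evades-target (stop d fr) = d , fr
    evades-target (go _ _ _ ev) = evades-target ev

    evades-⟫ : ∀ {p q r : Config j} {R : Run p q} {S : Run q r} {x y z} →
      Evades D R x y → Evades D S y z → Evades D (R ⟫ S) x z
    evades-⟫ (stop _ _) ev = ev
    evades-⟫ (go d fr s ev) ev′ = go d fr s (evades-⟫ ev ev′)

    evades-split : ∀ {p q r : Config j} (R : Run p q) {S : Run q r} {x z} →
      Evades D (R ⟫ S) x z → ∃ λ y → Evades D R x y × Evades D S y z
    evades-split [] (stop d fr) = _ , stop d fr , stop d fr
    evades-split [] (go d fr s ev) = _ , stop d fr , go d fr s ev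
    evades-split (m ∷ R) (go d fr s ev) with evades-split R ev
    ... | y , ev₁ , ev₂ = y , go d fr s ev₁ , ev₂

  evades-no-lions : ∀ {D : Vtx → Set} {p q : Config 0} (R : Run p q) {z} → D z → Evades D R z z
  evades-no-lions [] d = stop d λ ()
  evades-no-lions (m ∷ R) d = go d (λ ()) (inj₁ refl) (evades-no-lions R d)

  module _ (acyclic : Acyclic G) where

    Branch : Vtx → Vtx → Subset (n G)
    Branch v y = comp ⊤ v y

    root∈Branch : ∀ {v y} → Adj G v y → y ∈ Branch v y
    root∈Branch = root∈comp ∈⊤

    Near : Vtx → Vtx → Set
    Near a b = b ≡ a ⊎ Adj G a b

    near-sym : ∀ {a b} → Near a b → Near b a
    near-sym (inj₁ refl) = inj₁ refl
    near-sym (inj₂ e) = inj₂ (adj-sym e)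

    exit-through : ∀ {v r a b} → a ∈ Branch v r → b ∉ Branch v r → Near a b → Adj G a b × b ≡ v
    exit-through a∈ b∉ (inj₁ refl) = contradiction a∈ b∉
    exit-through {v} {b = b} a∈ b∉ (inj₂ e) with b Fin.≟ v
    ... | yes b≡v = e , b≡v
    ... | no b≢v = contradiction (comp-step a∈ e ∈⊤ b≢v) b∉

    -- Every way from one branch at `v` to another leads over `v`, so it takes at least two moves.
    near-other-branch : ∀ {v y r a b} → Adj G v y → Adj G v r → r ≢ y → a ∈ Branch v y → Near a b → b ∉ Branch v r
    near-other-branch vy vr r≢y a∈ (inj₁ refl) b∈ = r≢y (comp-disjoint acyclic vr vy b∈ a∈)
    near-other-branch vy vr r≢y a∈ (inj₂ e) b∈ =
      r≢y (comp-disjoint acyclic vr vy (comp-step b∈ (adj-sym e) ∈⊤ (comp-≢ a∈)) a∈)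

    -- As long as some lion is outside the branch at r, one lion fewer does the same work inside it:
    -- the lions outside wait at v, and one of them, the spare, is dropped.  When the spare enters the
    -- branch, its role passes to another outside lion, whose slot it takes over.
    module Slots {v r : Vtx} (vr : Adj G v r) {j : ℕ} where

      private
        T : Subset (n G)
        T = Branch v r

      ret : Vtx → Vtx
      ret w with w ∈? T
      ... | yes _ = w
      ... | no _ = v

      ret-∈ : ∀ {w} → w ∈ T → ret w ≡ w
      ret-∈ {w} w∈ with w ∈? T
      ... | yes _ = refl
      ... | no w∉ = contradiction w∈ w∉

      ret-∉ : ∀ {w} → w ∉ T → ret w ≡ v
      ret-∉ {w} w∉ with w ∈? T
      ... | yes w∈ = contradiction w∈ w∉
      ... | no _ = refl

      -- The branch is left and entered only over `v`, so collapsing its outside to `v` keeps every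
      -- move legal.
      ret-near : ∀ {a b} → Near a b → Near (ret a) (ret b)
      ret-near {a} {b} near with a ∈? T | b ∈? T
      ... | yes a∈ | yes b∈ = near
      ... | no a∉ | no b∉ = inj₁ refl
      ... | yes a∈ | no b∉ with exit-through a∈ b∉ near
      ...   | e , refl = inj₂ e
      ret-near {a} {b} near | no a∉ | yes b∈ with exit-through b∈ a∉ (near-sym near)
      ...   | e , refl = inj₂ (adj-sym e)

      Outsider : Config (suc j) → Set
      Outsider p = ∃ λ i → p i ∉ T

      record Assignment (p : Config (suc j)) : Set where
        field
          σ         : Fin j → Fin (suc j)
          spare     : Fin (suc j)
          spare-out : p spare ∉ T
          assigned  : ∀ a → a ≡ spare ⊎ ∃ λ i → σ i ≡ a

        slots : Config j
        slots i = ret (p (σ i))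

        find-slot : ∀ {a} → p a ∈ T → ∃ λ i → σ i ≡ a × slots i ≡ p a
        find-slot {a} pa∈ with assigned a
        ... | inj₁ refl = contradiction pa∈ spare-out
        ... | inj₂ (i , refl) = i , refl , ret-∈ pa∈

        slots-free : ∀ {x} → x ∈ T → Free slots x → Free p x
        slots-free x∈ fr a refl with find-slot x∈
        ... | i , _ , eq = fr i eq

      open Assignment

      initial : ∀ {p} → Outsider p → Assignment p
      initial (o , out) = record
        { σ = punchIn o ; spare = o ; spare-out = out
        ; assigned = λ a → case o Fin.≟ a of λ where
            (yes eq) → inj₁ (≡.sym eq)
            (no o≢a) → inj₂ (punchOut o≢a , Fin.punchIn-punchOut o≢a) }

      Follows : ∀ {p q} → Assignment p → Assignment q → Set
      Follows {p} {q} s t = ∀ i → σ t i ≡ σ s i ⊎ (σ s i ≡ spare t × σ t i ≡ spare s × q (spare s) ∈ T)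

      reassign : ∀ {p q} (s : Assignment p) → Outsider q → Σ (Assignment q) (Follows s)
      reassign {p} {q} s (o′ , out′) with q (spare s) ∈? T
      ... | no out = record { σ = σ s ; spare = spare s ; spare-out = out ; assigned = assigned s } , λ i → inj₁ refl
      ... | yes in′ = record { σ = σ′ ; spare = o′ ; spare-out = out′ ; assigned = assigned′ } , follows
        where
        σ′ : Fin j → Fin (suc j)
        σ′ i with σ s i Fin.≟ o′
        ... | yes _ = spare s
        ... | no _ = σ s i
        σ′-old : ∀ {i} → σ s i ≢ o′ → σ′ i ≡ σ s i
        σ′-old {i} ne with σ s i Fin.≟ o′
        ... | yes eq = contradiction eq ne
        ... | no _ = refl
        σ′-new : ∀ {i} → σ s i ≡ o′ → σ′ i ≡ spare s
        σ′-new {i} eq with σ s i Fin.≟ o′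
        ... | yes _ = refl
        ... | no ne = contradiction eq ne
        assigned′ : ∀ a → a ≡ o′ ⊎ ∃ λ i → σ′ i ≡ a
        assigned′ a with a Fin.≟ o′ | assigned s a
        ... | yes eq | _ = inj₁ eq
        ... | no a≢o′ | inj₂ (i , refl) = inj₂ (i , σ′-old a≢o′)
        ... | no a≢o′ | inj₁ refl with assigned s o′
        ...   | inj₁ refl = contradiction refl a≢o′
        ...   | inj₂ (i , eq) = inj₂ (i , σ′-new eq)
        follows : ∀ i → σ′ i ≡ σ s i ⊎ (σ s i ≡ o′ × σ′ i ≡ spare s × q (spare s) ∈ T)
        follows i with σ s i Fin.≟ o′
        ... | yes eq = inj₂ (eq , refl , in′)
        ... | no _ = inj₁ refl

      -- At a handover the old spare enters the branch from `v`, hence at `r`. The new spare was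
      -- outside, and the slot steps from `v` to `r`; or it is just leaving over `r`, and the slot
      -- rests at `r`.
      slots-move : ∀ {p q} (s : Assignment p) (t : Assignment q) → Follows s t → Move p q → Move (slots s) (slots t)
      slots-move {p} {q} s t f m i with f i
      ... | inj₁ eq rewrite eq = ret-near (m (σ s i))
      ... | inj₂ (eq , eq′ , in′) with exit-through in′ (spare-out s) (near-sym (m (spare s)))
      ...   | e , at-v rewrite eq | eq′ | ret-∈ in′ with p (spare t) ∈? T
      ...     | no _ = inj₂ (subst (λ w → Adj G w _) at-v (adj-sym e))
      ...     | yes p∈ with exit-through p∈ (spare-out t) (m (spare t))
      ...       | e′ , at-v′ = inj₁ (≡.trans (enters in′ e at-v) (≡.sym (enters p∈ e′ at-v′)))
        where
        enters : ∀ {a b} → a ∈ T → Adj G a b → b ≡ v → a ≡ r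
        enters a∈ e refl = comp-neighbour acyclic vr a∈ (adj-sym e)

      -- A lion moving from `y` to `x` inside the branch keeps its slot: a slot is handed over only
      -- when its lion becomes the spare, hence is outside after the move.
      slots-cross : ∀ {p q} (s : Assignment p) (t : Assignment q) → Follows s t → ∀ {x y} → x ∈ T → y ∈ T →
        (∀ i → slots s i ≡ y → slots t i ≢ x) → ∀ a → p a ≡ y → q a ≢ x
      slots-cross {q = q} s t f x∈ y∈ ok a refl refl with find-slot s y∈
      ... | i , refl , eq with f i
      ...   | inj₁ same = ok i eq (≡.trans (cong (λ b → ret (q b)) same) (ret-∈ x∈))
      ...   | inj₂ (is-spare , _) rewrite is-spare = contradiction x∈ (spare-out t)

      -- Inside the branch every lion is seen through its slot, so whoever evades the slots there
      -- evades all lions of `R`.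
      slots-run : ∀ {p q} (R : Run p q) → Along Outsider R → (s : Assignment p) →
        Σ (Assignment q) λ t → Σ (Run (slots s) (slots t)) λ R′ →
          ∀ {D : Vtx → Set} {x y} → (∀ {w} → D w → w ∈ T) → Evades D R′ x y → Evades D R x y
      slots-run [] _ s = s , [] , λ { D⊆T (stop d fr) → stop d (slots-free s (D⊆T d) fr) }
      slots-run (m ∷ R) (_ ∷ al) s with reassign s (along-head al)
      ... | s′ , f with slots-run R al s′
      ...   | t , R′ , transfer = t , slots-move s s′ f m ∷ R′ , λ where
        D⊆T (go d fr (inj₁ refl) ev) → go d (slots-free s (D⊆T d) fr) (inj₁ refl) (transfer D⊆T ev)
        D⊆T (go d fr (inj₂ (e , ok)) ev) →
          go d (slots-free s (D⊆T d) fr)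
            (inj₂ (e , slots-cross s s′ f (D⊆T d) (D⊆T (proj₁ (evades-source ev))) ok)) (transfer D⊆T ev)

    -- At such times the evader can stand at v and choose which branch to enter next.
    Gathered : Vtx → ∀ {j} → Config j → Set
    Gathered v p = ∃ λ y → Adj G v y × (∀ i → p i ∈ Branch v y)

    gathered? : ∀ v {j} (p : Config j) → Dec (Gathered v p)
    gathered? v p = Fin.any? (λ y → adj? v y ×-dec Fin.all? (λ i → p i ∈? Branch v y))

    next-gathering : ∀ {v j} {p q : Config j} (R : Run p q) → ¬ Gathered v p → Gathered v q →
      ∃₂ λ p₂ p₃ → Σ (Run p p₂) λ R₁ → Σ (Move p₂ p₃) λ m → Σ (Run p₃ q) λ R₂ →
        R ≡ R₁ ⟫ m ∷ R₂ × Along (λ p′ → ¬ Gathered v p′) R₁ × Gathered v p₃ × run-length R₂ < run-length R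
    next-gathering [] ¬g g = contradiction g ¬g
    next-gathering {v} (_∷_ {q = q} m R) ¬g g with gathered? v q
    ... | yes g′ = _ , _ , [] , m , R , refl , [] ¬g , g′ , ℕ.≤-refl
    ... | no ¬g′ with next-gathering R ¬g′ g
    ...   | p₂ , p₃ , R₁ , m′ , R₂ , refl , al , g₃ , lt =
            p₂ , p₃ , m ∷ R₁ , m′ , R₂ , refl , ¬g ∷ al , g₃ , ℕ.m≤n⇒m≤1+n lt

    avoid-two : ∀ (r : Fin 3 → Vtx) → (∀ i j → r i ≡ r j → i ≡ j) → ∀ y y′ → ∃ λ l → r l ≢ y × r l ≢ y′
    avoid-two r inj y y′ with Fin.any? (λ l → ¬? (r l Fin.≟ y) ×-dec ¬? (r l Fin.≟ y′))
    ... | yes found = found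
    ... | no none = ⊥-elim (absurd (hit fzero) (hit (fsuc fzero)) (hit (fsuc (fsuc fzero))))
      where
      hit : ∀ l → r l ≡ y ⊎ r l ≡ y′
      hit l with r l Fin.≟ y | r l Fin.≟ y′
      ... | yes eq | _ = inj₁ eq
      ... | no _ | yes eq = inj₂ eq
      ... | no ne | no ne′ = ⊥-elim (none (l , ne , ne′))
      clash : ∀ {i j x} → i ≢ j → r i ≡ x → r j ≡ x → ⊥
      clash i≢j eq eq′ = i≢j (inj _ _ (≡.trans eq (≡.sym eq′)))
      absurd : r fzero ≡ y ⊎ r fzero ≡ y′ → r (fsuc fzero) ≡ y ⊎ r (fsuc fzero) ≡ y′ →
        r (fsuc (fsuc fzero)) ≡ y ⊎ r (fsuc (fsuc fzero)) ≡ y′ → ⊥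
      absurd (inj₁ a) (inj₁ b) _ = clash (λ ()) a b
      absurd (inj₂ a) (inj₂ b) _ = clash (λ ()) a b
      absurd (inj₁ a) (inj₂ b) (inj₁ c) = clash (λ ()) a c
      absurd (inj₁ a) (inj₂ b) (inj₂ c) = clash (λ ()) b c
      absurd (inj₂ a) (inj₁ b) (inj₁ c) = clash (λ ()) b c
      absurd (inj₂ a) (inj₁ b) (inj₂ c) = clash (λ ()) a c

    -- Seen from inside a branch at `v`, lions that are all outside stand at `v`. This is the
    -- situation at both ends of a period of hiding, with `v` as `x`; the evader has to be back at
    -- `z` to step out again.
    Survives : ℕ → Subset (n G) → Set
    Survives j D = ∀ {p q : Config j} (R : Run p q) {z x} → z ∈ D → x ∉ D → Adj G z x →
      (∀ i → p i ≡ x) → (∀ i → q i ≡ x) → Evades (_∈ D) R z z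

    module Fork {D : Subset (n G)} {v : Vtx} (v∈D : v ∈ D) (r : Fin 3 → Vtx) (E : Fin 3 → Subset (n G))
      (vr : ∀ i → Adj G v (r i)) (r∈E : ∀ i → r i ∈ E i) (E⊆D : ∀ i → E i ⊆ D) (v∉E : ∀ i → v ∉ E i)
      (conn : ∀ i → IsConnected (E i)) (disjoint : ∀ i j {w} → w ∈ E i → w ∈ E j → i ≡ j)
      {j : ℕ} (survives : ∀ i → Survives j (E i)) where

      r-injective : ∀ i j → r i ≡ r j → i ≡ j
      r-injective i j eq = disjoint i j (r∈E i) (subst (_∈ E j) (≡.sym eq) (r∈E j))

      E⊆Branch : ∀ i {w} → w ∈ E i → w ∈ Branch v (r i)
      E⊆Branch i w∈ = comp⁺ (reach-map (λ u∈ → ∈⊤ , λ { refl → v∉E i u∈ }) (conn i (r∈E i) w∈))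

      -- Without a gathering the lions are never all in this branch, so `j` slots represent them. At
      -- both ends all lions are outside it, so the slots begin and end at `v`.
      hide : ∀ l {p q : Config (suc j)} (R : Run p q) → Along (λ p′ → ¬ Gathered v p′) R →
        (∀ i → p i ∉ Branch v (r l)) → (∀ i → q i ∉ Branch v (r l)) → Evades (_∈ D) R (r l) (r l)
      hide l R al p∉ q∉ = evades-map (E⊆D l) (proj₂ (proj₂ hidden) (E⊆Branch l)
        (survives l (proj₁ (proj₂ hidden)) (r∈E l) (v∉E l) (adj-sym (vr l)) (λ i → ret-∉ (p∉ _)) (λ i → ret-∉ (q∉ _))))
        where
        open Slots (vr l) {j}
        outsider : ∀ {p} → ¬ Gathered v p → Outsider p
        outsider {p} ¬g = Fin.¬∀⟶∃¬ _ (λ i → p i ∈ Branch v (r l)) (λ i → p i ∈? Branch v (r l))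
          (λ all → ¬g (r l , vr l , all))
        outsiders : ∀ {p q} {R : Run p q} → Along (λ p′ → ¬ Gathered v p′) R → Along Outsider R
        outsiders ([] ¬g) = [] (outsider ¬g)
        outsiders (¬g ∷ al) = outsider ¬g ∷ outsiders al
        hidden = slots-run R (outsiders al) (initial (fzero , p∉ fzero))

      core : ∀ {p q : Config (suc j)} (R : Run p q) → Gathered v p → Gathered v q → Evades (_∈ D) R v v
      core R = loop (run-length R) R ℕ.≤-refl
        where
        free : ∀ {p : Config (suc j)} → Gathered v p → Free p v
        free (_ , _ , p∈) i = comp-≢ (p∈ i)
        loop : ∀ {p q : Config (suc j)} m (R : Run p q) → run-length R ≤ m →
          Gathered v p → Gathered v q → Evades (_∈ D) R v v
        loop m [] _ g _ = stop v∈D (free g)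
        loop (suc m) (_∷_ {q = p₁} mv R) (s≤s le) g g′ with gathered? v p₁
        ... | yes g₁ = go v∈D (free g) (inj₁ refl) (loop m R le g₁ g′)
        ... | no ¬g₁ with next-gathering R ¬g₁ g′
        ...   | p₂ , p₃ , R₁ , mv′ , R₂ , refl , al , g₃ , lt with g | g₃
        ...     | y , vy , p∈ | y₃ , vy₃ , p₃∈ with avoid-two r r-injective y y₃
        ...       | l , l≢y , l≢y₃ =
          -- The step to `r l` is made during the move out of one gathering and the step back during
          -- the move into the next. So both ends of `R₁` are one move away from a gathering in
          -- another branch, and no lion is in the hiding branch then.
          go v∈D (free g) (inj₂ (vr l , λ i eq _ → apart vy l≢y (p∈ i) eq))
            (evades-⟫ (hide l R₁ al (λ i → near-other-branch vy (vr l) l≢y (p∈ i) (mv i)) outside₂)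
              (go (E⊆D l (r∈E l)) (λ i eq → outside₂ i (subst (_∈ Branch v (r l)) (≡.sym eq) (root∈Branch (vr l))))
                (inj₂ (adj-sym (vr l) , λ i _ eq → apart vy₃ l≢y₃ (p₃∈ i) eq))
                (loop m R₂ (ℕ.≤-trans (ℕ.<⇒≤ lt) le) g₃ g′)))
          where
          apart : ∀ {y a} → Adj G v y → r l ≢ y → a ∈ Branch v y → a ≢ r l
          apart vy ne a∈ refl = ne (comp-disjoint acyclic (vr l) vy (root∈Branch (vr l)) a∈)
          outside₂ : ∀ i → p₂ i ∉ Branch v (r l)
          outside₂ i = near-other-branch vy₃ (vr l) l≢y₃ (p₃∈ i) (near-sym (mv′ i))

      unsnoc : ∀ {i} {p q r : Config i} (m : Move p q) (R : Run q r) →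
        ∃ λ p₂ → Σ (Run p p₂) λ R₁ → Σ (Move p₂ r) λ m′ → m ∷ R ≡ R₁ ⟫ m′ ∷ []
      unsnoc m [] = _ , [] , m , refl
      unsnoc m (m₁ ∷ R) with unsnoc m₁ R
      ... | p₂ , R₁ , m′ , eq = p₂ , m ∷ R₁ , m′ , cong (m ∷_) eq

      -- The lions trail behind the evader on its way from z to v, and lead it on its way back.
      travel : ∀ {S : Vtx → Set} → (∀ {w} → S w → w ∈ D) → ∀ {z x} → SimplePath S z v → ¬ S x → Adj G z x →
        ∀ {p q : Config (suc j)} (R : Run p q) → (∀ i → p i ∈ Branch z x) → (∀ i → q i ∈ Branch z x) →
        Evades (_∈ D) R z z
      travel S⊆D (done _) _ zx R p∈ q∈ = core R (_ , zx , p∈) (_ , zx , q∈)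
      -- With fewer than two moves there is no time to go and come back. The evader stays at `z`,
      -- outside the branch that holds the lions at both ends.
      travel S⊆D (step s _ _) _ _ [] p∈ q∈ = stop (S⊆D s) (λ i → comp-≢ (p∈ i))
      travel S⊆D (step s _ _) _ _ (m ∷ []) p∈ q∈ =
        go (S⊆D s) (λ i → comp-≢ (p∈ i)) (inj₁ refl) (stop (S⊆D s) (λ i → comp-≢ (q∈ i)))
      travel {S} S⊆D {z} {x} (step {b} s zb path) x∉S zx (m ∷ (m₁ ∷ R)) p∈ q∈ with unsnoc m₁ R
      ... | p₂ , R₁ , m′ , eq rewrite eq =
        -- The first and the last move are spent on the edge between `z` and `b`. No lion crosses it
        -- against the evader, because `b` is outside the branch where the lions start and end.
        go (S⊆D s) (λ i → comp-≢ (p∈ i)) (inj₂ (zb , λ i eq₁ _ → b∉ (subst (_∈ Branch z x) eq₁ (p∈ i))))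
          (evades-⟫ inner
            (go (proj₁ (evades-target inner)) (proj₂ (evades-target inner))
              (inj₂ (adj-sym zb , λ i _ eq₁ → b∉ (subst (_∈ Branch z x) eq₁ (q∈ i))))
              (stop (S⊆D s) (λ i → comp-≢ (q∈ i)))))
        where
        b≢x : b ≢ x
        b≢x refl = x∉S (proj₁ (path-source path))
        b∉ : b ∉ Branch z x
        b∉ b∈ = b≢x (comp-neighbour acyclic zx b∈ zb)
        -- One move out of the branch at `z` reaches `z` at most, and both lie in the branch at `b`
        -- towards `z`.
        trail : ∀ {a a′} → a ∈ Branch z x → Near a a′ → a′ ∈ Branch b z
        trail a∈ (inj₁ refl) = comp-nest acyclic ∈⊤ (adj-sym zb) zx (b≢x ∘ ≡.sym) a∈
        trail a∈ (inj₂ e) = comp-step (comp-nest acyclic ∈⊤ (adj-sym zb) zx (b≢x ∘ ≡.sym) a∈) e ∈⊤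
          λ { refl → b∉ (comp-step a∈ e ∈⊤ (adj⇒≢ (adj-sym zb))) }
        inner : Evades (_∈ D) R₁ b b
        inner = travel (S⊆D ∘ proj₁) path (λ (_ , z≢z) → z≢z refl) (adj-sym zb) R₁
          (λ i → trail (p∈ i) (m i)) (λ i → trail (q∈ i) (near-sym (m′ i)))

    -- Induction on the obstruction: `core` copes with one lion more than the three branches
    -- survive, and `travel` leads the evader from `z` to `v` and back. An edge has order 1, which
    -- leaves no lion.
    survive : ∀ {k D} → Obstruction k D → IsConnected D → ∀ {j} → j < k → Survives j D
    survive _ _ {zero} _ R z∈D _ _ _ _ = evades-no-lions R z∈D
    survive (edge _ _ _) _ {suc j} (s≤s ())
    survive (fork v v∈D r E vr r∈E E⊆D v∉E conn disjoint obs) connected {suc j} (s≤s j<k) R {z} {x} z∈D x∉D zx p≡x q≡x =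
      travel id (simple-path (connected z∈D v∈D)) x∉D zx R (at-x p≡x) (at-x q≡x)
      where
      open Fork v∈D r E vr r∈E E⊆D v∉E conn disjoint (λ i → survive (obs i) (conn i) j<k)
      at-x : ∀ {p : Config (suc j)} → (∀ i → p i ≡ x) → ∀ i → p i ∈ Branch z x
      at-x p≡x i = subst (_∈ Branch z x) (≡.sym (p≡x i)) (root∈Branch zx)

  walk-length : ∀ {a b} → Walk G a b → ℕ
  walk-length here = 0
  walk-length (step _ w) = suc (walk-length w)

  walk-at : ∀ {a b} → Walk G a b → ℕ → Vtx
  walk-at {a} w zero = a
  walk-at {a} here (suc t) = a
  walk-at (step _ w) (suc t) = walk-at w t

-- Separating bags, pigeonhole and finite enumerations.

contiguous-separator : ∀ {A : Set} {w : A} l₁ {B l₂} → Contiguous w (l₁ ++ B ∷ l₂) →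
  Any (w ∈ₗ_) l₁ → Any (w ∈ₗ_) l₂ → w ∈ₗ B
contiguous-separator {w = w} = go
  where
  starts : ∀ l₁ {B l₂} → Starts w (l₁ ++ B ∷ l₂) → Any (w ∈ₗ_) l₂ → w ∈ₗ B
  starts l₁ ([] , _ , refl , _ , no-w) w∈₂ = contradiction (Any.++⁺ʳ l₁ (there w∈₂)) (All.All¬⇒¬Any no-w)
  starts [] (_ ∷ ys , zs , refl , w∈ ∷ _ , _) _ = w∈
  starts (_ ∷ l₁) (_ ∷ ys , zs , eq , _ ∷ all-w , no-w) w∈₂ =
    starts l₁ (ys , zs , List.∷-injectiveʳ eq , all-w , no-w) w∈₂
  go : ∀ l₁ {B l₂} → Contiguous w (l₁ ++ B ∷ l₂) → Any (w ∈ₗ_) l₁ → Any (w ∈ₗ_) l₂ → w ∈ₗ B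
  go l₁ ([] , _ , refl , _ , s) _ w∈₂ = starts l₁ s w∈₂
  go (_ ∷ l₁) (_ ∷ xs , L , eq , w∉ ∷ _ , s) (here w∈) _ = contradiction (subst (w ∈ₗ_) (List.∷-injectiveˡ eq) w∈) w∉
  go (_ ∷ l₁) (_ ∷ xs , L , eq , _ ∷ no-w , s) (there w∈₁) w∈₂ =
    go l₁ (xs , L , List.∷-injectiveʳ eq , no-w , s) w∈₁ w∈₂

unused : ∀ {m} (g : List (Fin m)) → length g < m → ∃ λ i → i ∉ₗ g
unused {m} g lt = Fin.¬∀⟶∃¬ m (_∈ₗ g) (_∈ₗ? g) λ all →
  ℕ.<⇒≱ lt (Fin.injective⇒≤ {f = λ i → Any.index (all i)}
    (λ {i} {j} eq → ≡.trans (Any.lookup-index (all i))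
      (≡.trans (cong (List.lookup g) eq) (≡.sym (Any.lookup-index (all j))))))
  where open DecMembership (Fin._≟_ {m}) renaming (_∈?_ to _∈ₗ?_)

Listing : Set → Set
Listing A = Σ (List A) λ xs → ∀ x → x ∈ₗ xs

listing-vec : ∀ {A} → Listing A → ∀ k → Listing (Vec A k)
listing-vec _ zero = ([] ∷ []) , λ { [] → here refl }
listing-vec (xs , all) (suc k) with listing-vec (xs , all) k
... | vs , all′ = List.cartesianProductWith _∷_ xs vs , λ { (x ∷ v) → ∈-cartesianProductWith⁺ _∷_ (all x) (all′ v) }

listing-× : ∀ {A B} → Listing A → Listing B → Listing (A × B)
listing-× (xs , all) (ys , all′) = List.cartesianProduct xs ys , λ (x , y) → ∈-cartesianProduct⁺ (all x) (all′ y)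

-- Decided by `star?` on the positions in the listing. Entries may be repeated, so `enc` picks one
-- position and every step is transported along `dec-enc`.
connects? : ∀ {A : Set} → Listing A → {R : A → A → Set} → (∀ a b → Dec (R a b)) →
  {I F : A → Set} → Decidable I → Decidable F → Dec (∃₂ λ a b → I a × F b × Star R a b)
connects? {A} (xs , all) {R} R? {I} {F} I? F? = map′
  (λ (i , j , pi , pj , s) → dec i , dec j , pi , pj , decode s)
  (λ (a , b , pa , pb , s) → enc a , enc b , subst I (≡.sym (dec-enc a)) pa , subst F (≡.sym (dec-enc b)) pb , encode s)
  (Fin.any? λ i → Fin.any? λ j → I? (dec i) ×-dec F? (dec j) ×-dec star? (λ i j → R? (dec i) (dec j)) i j)
  where
  dec : Fin (length xs) → A
  dec = List.lookup xs
  enc : A → Fin (length xs)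
  enc a = Any.index (all a)
  dec-enc : ∀ a → dec (enc a) ≡ a
  dec-enc a = ≡.sym (Any.lookup-index (all a))
  decode : ∀ {i j} → Star (λ i j → R (dec i) (dec j)) i j → Star R (dec i) (dec j)
  decode ε = ε
  decode (r ◅ s) = r ◅ decode s
  encode : ∀ {a b} → Star R a b → Star (λ i j → R (dec i) (dec j)) (enc a) (enc b)
  encode ε = ε
  encode (_◅_ {a} {b} r s) = ≡.subst₂ R (≡.sym (dec-enc a)) (≡.sym (dec-enc b)) r ◅ encode s

-- Strategies

module Clearing (G : Graph) where

  open Components G
  open Layouts G
  open Lions G

  Everywhere : Vtx → Set
  Everywhere _ = Unit

  -- Runs grow at the front, contaminated sets at the end; `prefix-extend` and `prefix-shorten`
  -- mediate between the two.
  prefix : ∀ {j} (f : ℕ → Config j) → (∀ t → Move (f t) (f (suc t))) → ∀ t → Run (f 0) (f t)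
  prefix f mv zero = []
  prefix f mv (suc t) = mv 0 ∷ prefix (f ∘ suc) (mv ∘ suc) t

  prefix-extend : ∀ {j} (f : ℕ → Config j) mv t {D x y z} → Evades D (prefix f mv t) x y →
    Slips (f t) (f (suc t)) y z → D z → Free (f (suc t)) z → Evades D (prefix f mv (suc t)) x z
  prefix-extend f mv zero (stop d fr) s d′ fr′ = go d fr s (stop d′ fr′)
  prefix-extend f mv (suc t) (go d fr s₀ ev) s d′ fr′ =
    go d fr s₀ (prefix-extend (f ∘ suc) (mv ∘ suc) t ev s d′ fr′)

  prefix-shorten : ∀ {j} (f : ℕ → Config j) mv t {D x z} → Evades D (prefix f mv (suc t)) x z →
    ∃ λ y → Evades D (prefix f mv t) x y × Slips (f t) (f (suc t)) y z × Free (f (suc t)) z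
  prefix-shorten f mv zero (go d fr s (stop d′ fr′)) = _ , stop d fr , s , fr′
  prefix-shorten f mv (suc t) (go d fr s₀ ev) with prefix-shorten (f ∘ suc) (mv ∘ suc) t ev
  ... | y , ev′ , s , fr′ = y , go d fr s₀ ev′ , s , fr′

  module _ {j} (S : LionStrategy G j) where

    strategy-run : ∀ t → Run (pos S 0) (pos S t)
    strategy-run = prefix (pos S) (moves S)

    -- Contamination traces back, step by step, to a vertex contaminated before; read forwards, the
    -- trace is an evader.
    W⇒evades : ∀ t {v} → W S t v → ∃ λ x → Evades Everywhere (strategy-run t) x v
    W⇒evades zero ¬L = _ , stop tt (λ i eq → ¬L (i , eq))
    W⇒evades (suc t) (¬L , inj₁ w) with W⇒evades t w
    ... | x , ev = x , prefix-extend (pos S) (moves S) t ev (inj₁ refl) tt (λ i eq → ¬L (i , eq))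
    W⇒evades (suc t) (¬L , inj₂ (u , wu , e , ¬vu , _)) with W⇒evades t wu
    ... | x , ev = x , prefix-extend (pos S) (moves S) t ev
          (inj₂ (adj-sym e , λ i eq eq′ → ¬vu (i , eq , eq′))) tt (λ i eq → ¬L (i , eq))

    evades⇒W : ∀ t {D x v} → Evades D (strategy-run t) x v → W S t v
    evades⇒W zero (stop _ fr) (i , eq) = fr i eq
    evades⇒W (suc t) ev with prefix-shorten (pos S) (moves S) t ev
    ... | y , ev′ , s , fr = (λ (i , eq) → fr i eq) , (case s of λ where
      (inj₁ refl) → inj₁ (evades⇒W t ev′)
      (inj₂ (e , ok)) → inj₂ (y , evades⇒W t ev′ , adj-sym e , (λ (i , eq , eq′) → ok i eq eq′) ,
        -- A lion crossing in the evader's own direction would have stood on the evader before the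
        -- move.
        λ (i , eq , _) → proj₂ (evades-target ev′) i eq))

  run-pos : ∀ {j} {p q : Config j} → Run p q → ℕ → Config j
  run-pos {p = p} R zero = p
  run-pos {p = p} [] (suc t) = p
  run-pos (m ∷ R) (suc t) = run-pos R t

  run-moves : ∀ {j} {p q : Config j} (R : Run p q) t → Move (run-pos R t) (run-pos R (suc t))
  run-moves [] zero i = inj₁ refl
  run-moves [] (suc t) i = inj₁ refl
  run-moves (m ∷ R) zero = m
  run-moves (m ∷ R) (suc t) = run-moves R t

  prefix-run-pos : ∀ {j} {p q : Config j} (R : Run p q) {D x y} →
    Evades D (prefix (run-pos R) (run-moves R) (run-length R)) x y → Evades D R x y
  prefix-run-pos [] (stop d fr) = stop d fr
  prefix-run-pos (m ∷ R) (go d fr s ev) = go d fr s (prefix-run-pos R ev)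

  run⇒clearable : ∀ {j} {p q : Config j} → 1 ≤ j → (R : Run p q) →
    (∀ {x y} → ¬ Evades Everywhere R x y) → ClearableWith G j
  run⇒clearable 1≤j R none = 1≤j , S , run-length R , λ v w → none (prefix-run-pos R (proj₂ (W⇒evades S (run-length R) w)))
    where
    S : LionStrategy G _
    S = record { pos = run-pos R ; moves = run-moves R }

  module _ (connected : Connected G) where

    walk-near : ∀ {a b} (w : Walk G a b) t → walk-at w (suc t) ≡ walk-at w t ⊎ Adj G (walk-at w t) (walk-at w (suc t))
    walk-near here zero = inj₁ refl
    walk-near here (suc t) = inj₁ refl
    walk-near (step e w) zero = inj₂ e
    walk-near (step e w) (suc t) = walk-near w t

    walk-end : ∀ {a b} (w : Walk G a b) {t} → walk-length w ≤ t → walk-at w t ≡ b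
    walk-end here {zero} _ = refl
    walk-end here {suc t} _ = refl
    walk-end (step _ w) {suc t} (s≤s le) = walk-end w le

    transfer-run : ∀ {j} (p q : Config j) → Run p q
    -- The last move is a rest: the configuration reached agrees with `q` pointwise, and this move
    -- makes `q` itself the end of the run.
    transfer-run {j} p q = prefix f (λ t i → walk-near (w i) t) M ⟫
      (λ i → inj₁ (≡.sym (walk-end (w i) (≤-maxFin (λ i → walk-length (w i)) i)))) ∷ []
      where
      w : ∀ i → Walk G (p i) (q i)
      w i = connected (p i) (q i)
      f : ℕ → Config j
      f t i = walk-at (w i) t
      M : ℕ
      M = maxFin (λ i → walk-length (w i))

    -- The strategy is extended at both ends by walks from and to `home`, where the lions are
    -- gathered. An evader of the longer run is uncaught during the strategy, so contamination is
    -- left at time `T`.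
    obstruction⇒¬clearable : Acyclic G → ∀ {k j} → Obstruction k ⊤ → j < k → ¬ ClearableWith G j
    obstruction⇒¬clearable acyclic {j = zero} _ _ (() , _)
    obstruction⇒¬clearable acyclic {j = suc j} (edge _ _ _) (s≤s ())
    obstruction⇒¬clearable acyclic {j = suc j} (fork v v∈ r E vr r∈E E⊆ v∉E conn disjoint obs) (s≤s j<k) (_ , S , T , clear) =
      clear _ (evades⇒W S T (proj₁ (proj₂ (evades-split (strategy-run S T) (proj₂ (proj₂ (evades-split before evasion)))))))
      where
      home : Config (suc j)
      home _ = r fzero
      gathered : Gathered acyclic v home
      gathered = r fzero , vr fzero , λ _ → root∈Branch acyclic (vr fzero)
      before : Run home (pos S 0)
      before = transfer-run home (pos S 0)
      evasion : Evades (_∈ ⊤) (before ⟫ strategy-run S T ⟫ transfer-run (pos S T) home) v v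
      evasion = Fork.core acyclic v∈ r E vr r∈E E⊆ v∉E conn disjoint
        (λ i → survive acyclic (obs i) (conn i) j<k) _ gathered gathered

    -- Sweeping along a layout.

    module Sweep {m : ℕ} (p₀ : Config m) where

      Clean : ∀ {p} → Run p₀ p → (Vtx → Set) → Set
      Clean R S = ∀ {x y} → Evades Everywhere R x y → ¬ S y

      Guards : Config m → List (Fin m) → (Vtx → Set) → Set
      Guards p g S = ∀ {w u} → S w → ¬ S u → Adj G w u → ∃ λ i → i ∈ₗ g × p i ≡ w

      -- Contamination enters `S` only over a boundary vertex, and after the move a lion stands on
      -- each of these.
      clean-step : ∀ {p q g S} {R : Run p₀ p} → (mv : Move p q) → Clean R S → Guards q g S → Clean (R ⟫ mv ∷ []) S
      clean-step {R = R} mv clean guards ev Sy with evades-split R ev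
      ... | y , ev₁ , go _ _ s (stop _ fr) with s
      ...   | inj₁ refl = clean ev₁ Sy
      ...   | inj₂ (e , _) with guards Sy (clean ev₁) (adj-sym e)
      ...     | i , _ , eq = fr i eq

      relocate : Config m → Fin m → Vtx → Config m
      relocate p i w k with k Fin.≟ i
      ... | yes _ = w
      ... | no _ = p k

      relocate-≡ : ∀ p i w → relocate p i w i ≡ w
      relocate-≡ p i w with i Fin.≟ i
      ... | yes _ = refl
      ... | no i≢i = contradiction refl i≢i

      relocate-≢ : ∀ p {i} w {k} → k ≢ i → relocate p i w k ≡ p k
      relocate-≢ p {i} w {k} k≢i with k Fin.≟ i
      ... | yes eq = contradiction eq k≢i
      ... | no _ = refl

      relocate-move : ∀ {p i w} → Adj G (p i) w → Move p (relocate p i w)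
      relocate-move {i = i} e k with k Fin.≟ i
      ... | yes refl = inj₂ e
      ... | no _ = inj₁ refl

      guards-resp : ∀ {p q g S} → (∀ {i} → i ∈ₗ g → q i ≡ p i) → Guards p g S → Guards q g S
      guards-resp agree guards Sw ¬Su e with guards Sw ¬Su e
      ... | i , i∈ , eq = i , i∈ , ≡.trans (agree i∈) eq

      -- Only lion `i` moves while the guards stand still, so `S` stays clean however long the walk
      -- is.
      send : ∀ {g S a b i p} → i ∉ₗ g → Walk G a b → p i ≡ a → (R : Run p₀ p) → Clean R S → Guards p g S →
        ∃ λ q → Σ (Run p₀ q) λ R′ → Clean R′ S × q i ≡ b × (∀ {k} → k ∈ₗ g → q k ≡ p k)
      send i∉ here at R clean guards = _ , R , clean , at , λ _ → refl
      send {g} {S} {i = i} {p} i∉ (step {w = w} e walk) refl R clean guards =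
        let q , R′ , clean′ , at , agree′ = send i∉ walk (relocate-≡ p i w) (R ⟫ relocate-move e ∷ [])
              (clean-step {g = g} (relocate-move e) clean guards′) guards′
        in q , R′ , clean′ , at , λ k∈ → ≡.trans (agree′ k∈) (agree k∈)
        where
        agree : ∀ {k} → k ∈ₗ g → relocate p i w k ≡ p k
        agree k∈ = relocate-≢ p w λ { refl → i∉ k∈ }
        guards′ : Guards (relocate p i w) g S
        guards′ = guards-resp agree guards

      occupy : ∀ {S} todo g {p} (R : Run p₀ p) → Clean R S → Guards p g S → length todo + length g ≤ m →
        ∃ λ q → Σ (Run p₀ q) λ R′ → Clean R′ S × (∀ {i} → i ∈ₗ g → q i ≡ p i) × (∀ {b} → b ∈ₗ todo → ∃ λ i → q i ≡ b)
      occupy [] g R clean guards le = _ , R , clean , (λ _ → refl) , λ ()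
      occupy (b ∷ todo) g {p} R clean guards le with unused g (ℕ.≤-trans (s≤s (ℕ.m≤n+m (length g) (length todo))) le)
      ... | i , i∉ with send i∉ (connected (p i) b) refl R clean guards
      ...   | p₁ , R₁ , clean₁ , at , agree with
                occupy todo (i ∷ g) R₁ clean₁ (λ Sw ¬Su e → let k , k∈ , eq = guards-resp agree guards Sw ¬Su e in k , there k∈ , eq)
                  (ℕ.≤-trans (ℕ.≤-reflexive (ℕ.+-suc (length todo) (length g))) le)
      ...     | q , R′ , clean′ , agree′ , occupied = q , R′ , clean′ ,
                (λ k∈ → ≡.trans (agree′ (there k∈)) (agree k∈)) ,
                λ { (here refl) → i , ≡.trans (agree′ (here refl)) at ; (there b∈) → occupied b∈ }

      partition : ∀ (p : Config m) B → ∃₂ λ todo g → length todo + length g ≤ length B ×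
        (∀ {w} → w ∈ₗ B → (∃ λ i → i ∈ₗ g × p i ≡ w) ⊎ (w ∈ₗ todo × Free p w))
      partition p [] = [] , [] , z≤n , λ ()
      partition p (b ∷ B) with partition p B | Fin.any? (λ i → p i Fin.≟ b)
      ... | todo , g , le , sorted | yes (i , eq) = todo , i ∷ g ,
            ℕ.≤-trans (ℕ.≤-reflexive (ℕ.+-suc (length todo) (length g))) (s≤s le) , λ where
              (here refl) → inj₁ (i , here refl , eq)
              (there w∈) → Sum.map₁ (λ (k , k∈ , eq′) → k , there k∈ , eq′) (sorted w∈)
      ... | todo , g , le , sorted | no vacant = b ∷ todo , g , s≤s le , λ where
              (here refl) → inj₂ (here refl , λ i eq → vacant (i , eq))
              (there w∈) → Sum.map₂ (λ (t∈ , fr) → there t∈ , fr) (sorted w∈)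

      module _ (L : Layout m (_∈ ⊤)) where

        Seen : List (List Vtx) → Vtx → Set
        Seen pre w = Any (w ∈ₗ_) pre

        separator : ∀ {pre B rest} → bags L ≡ pre ++ B ∷ rest → ∀ {w} → Seen pre w → Any (w ∈ₗ_) (B ∷ rest) → w ∈ₗ B
        separator eq seen (here w∈) = w∈
        separator {pre} eq seen (there w∈) =
          contiguous-separator pre (subst (Contiguous _) eq (contiguous L _)) seen w∈

        ahead : ∀ {pre rest} → bags L ≡ pre ++ rest → ∀ {w u} → ¬ Seen pre u → Adj G w u → Any (w ∈ₗ_) rest
        ahead {pre} eq ¬seen e with Any.++⁻ pre (subst (Any _) eq (joins L ∈⊤ ∈⊤ e))
        ... | inj₁ before = contradiction (Any.map proj₂ before) ¬seen
        ... | inj₂ after = Any.map proj₁ after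

        -- Invariant: the bags in `pre` are clean, and those of their vertices that occur again lie
        -- in the fully occupied bag `B`.
        sweep : ∀ pre rest → bags L ≡ pre ++ rest → ∀ B → (∀ {w} → Seen pre w → Any (w ∈ₗ_) rest → w ∈ₗ B) →
          ∀ {p} → (∀ {w} → w ∈ₗ B → ∃ λ i → p i ≡ w) → (R : Run p₀ p) → Clean R (Seen pre) →
          ∃ λ q → Σ (Run p₀ q) λ R′ → Clean R′ (Seen (bags L))
        sweep pre [] eq B _ _ R clean =
          _ , R , λ ev seen → clean ev (subst (Any _) (≡.trans eq (List.++-identityʳ pre)) seen)
        sweep pre (B′ ∷ rest) eq B inB {p} guarded R clean with partition p B′
        ... | todo , g , le , sorted with
                occupy todo g R clean
                  -- A boundary vertex shares a later bag with its unseen neighbour, so it lies in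
                  -- `B` and in `B′`. A lion stands on it already, and it was sorted to `g`.
                  (λ seen ¬seen e → case sorted (separator eq seen (ahead eq ¬seen e)) of λ where
                    (inj₁ found) → found
                    (inj₂ (_ , vacant)) → let i , at = guarded (inB seen (ahead eq ¬seen e)) in contradiction at (vacant i))
                  (ℕ.≤-trans le (All.lookup (bound L) (subst (B′ ∈ₗ_) (≡.sym eq) (Any.++⁺ʳ pre (here refl)))))
        ...   | q , R′ , clean′ , agree , occupied =
                sweep (pre ++ B′ ∷ []) rest (≡.trans eq (≡.sym (List.++-assoc pre (B′ ∷ []) rest))) B′
                  inB′ guarded′ R′ clean″
          where
          inB′ : ∀ {w} → Seen (pre ++ B′ ∷ []) w → Any (w ∈ₗ_) rest → w ∈ₗ B′
          inB′ seen w∈ with Any.++⁻ pre seen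
          ... | inj₁ seen′ = separator eq seen′ (there w∈)
          ... | inj₂ (here w∈B′) = w∈B′
          guarded′ : ∀ {w} → w ∈ₗ B′ → ∃ λ i → q i ≡ w
          guarded′ w∈ with sorted w∈
          ... | inj₁ (i , i∈ , at) = i , ≡.trans (agree i∈) at
          ... | inj₂ (w∈todo , _) = occupied w∈todo
          clean″ : Clean R′ (Seen (pre ++ B′ ∷ []))
          clean″ ev seen with Any.++⁻ pre seen
          ... | inj₁ seen′ = clean′ ev seen′
          ... | inj₂ (here w∈B′) with guarded′ w∈B′
          ...   | i , at = proj₂ (evades-target ev) i at

    layout⇒clearable : ∀ {m} → 1 ≤ m → 0 < n G → Layout m (_∈ ⊤) → ClearableWith G m
    layout⇒clearable {m} 1≤m 0<n L with Sweep.sweep (λ _ → fromℕ< 0<n) L [] (bags L) refl [] (λ ()) (λ ()) [] (λ _ ())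
    ... | _ , R , clean = run⇒clearable 1≤m R (λ ev → clean ev (covers L ∈⊤))

  -- Deciding whether `k` lions clear the graph.

  module _ (k : ℕ) where

    State : Set
    State = Vec Vtx k × Subset (n G)

    listing-state : Listing State
    listing-state = listing-× (listing-vec (allFin (n G) , ∈-allFin) k)
                              (listing-vec ((true ∷ false ∷ []) , λ { true → here refl ; false → there (here refl) }) (n G))

    free? : ∀ (p : Config k) → Decidable (Free p)
    free? p x = Fin.all? (λ i → ¬? (p i Fin.≟ x))

    move? : ∀ (p q : Config k) → Dec (Move p q)
    move? p q = Fin.all? (λ i → (q i Fin.≟ p i) ⊎-dec adj? (p i) (q i))

    slips? : ∀ (p q : Config k) x y → Dec (Slips p q x y)
    slips? p q x y = (x Fin.≟ y) ⊎-dec (adj? x y ×-dec Fin.all? (λ i → (p i Fin.≟ y) →-dec ¬? (q i Fin.≟ x)))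

    spread? : ∀ (p q : Config k) X → Decidable (λ y → Free q y × ∃ λ x → x ∈ X × Slips p q x y)
    spread? p q X y = free? q y ×-dec Fin.any? (λ x → x ∈? X ×-dec slips? p q x y)

    Transition : State → State → Set
    Transition (p , X) (q , Y) = Move (Vec.lookup p) (Vec.lookup q) × Y ≡ comprehension (spread? (Vec.lookup p) (Vec.lookup q) X)

    Initial Final : State → Set
    Initial (p , X) = X ≡ comprehension (free? (Vec.lookup p))
    Final (p , X) = ∀ x → x ∉ X

    clears? : Dec (∃₂ λ s t → Initial s × Final t × Star Transition s t)
    clears? = connects? listing-state
      (λ (p , X) (q , Y) → move? (Vec.lookup p) (Vec.lookup q) ×-dec Vec.≡-dec Bool._≟_ Y _)
      (λ (p , X) → Vec.≡-dec Bool._≟_ X _) (λ (p , X) → Fin.all? (λ x → ¬? (x ∈? X)))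

    -- The set in a state contains every vertex an evader can have reached, so a run ending with the
    -- empty set clears. The converse inclusion is `state-evades`.
    transitions⇒run : ∀ {s t} → Star Transition s t → Σ (Run (Vec.lookup (proj₁ s)) (Vec.lookup (proj₁ t))) λ R →
      ∀ {D x y} → x ∈ proj₂ s → Evades D R x y → y ∈ proj₂ t
    transitions⇒run ε = [] , λ { x∈ (stop _ _) → x∈ }
    transitions⇒run (_◅_ {p , X} {q , _} (mv , refl) s) with transitions⇒run s
    ... | R , track = mv ∷ R , λ { x∈ (go _ _ sl ev) →
          track (∈-comprehension⁺ (spread? _ _ X) (proj₂ (evades-source ev) , _ , x∈ , sl)) ev }

    module _ (S : LionStrategy G k) where

      state : ℕ → State
      state zero = tabulate (pos S 0) , comprehension (free? (Vec.lookup (tabulate (pos S 0))))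
      state (suc t) = tabulate (pos S (suc t)) ,
        comprehension (spread? (Vec.lookup (proj₁ (state t))) (Vec.lookup (tabulate (pos S (suc t)))) (proj₂ (state t)))

      position : ∀ t i → Vec.lookup (proj₁ (state t)) i ≡ pos S t i
      position zero = Vec.lookup∘tabulate (pos S 0)
      position (suc t) = Vec.lookup∘tabulate (pos S (suc t))

      state-transitions : ∀ t → Star Transition (state 0) (state t)
      state-transitions zero = ε
      state-transitions (suc t) = state-transitions t ◅◅
        ((λ i → ≡.subst₂ (λ a b → b ≡ a ⊎ Adj G a b) (≡.sym (position t i)) (≡.sym (position (suc t) i)) (moves S t i)) , refl) ◅ ε

      state-evades : ∀ t {y} → y ∈ proj₂ (state t) → ∃ λ x → Evades Everywhere (strategy-run S t) x y
      state-evades zero y∈ = _ , stop tt λ i eq → ∈-comprehension⁻ (free? _) y∈ i (≡.trans (position 0 i) eq)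
      state-evades (suc t) y∈ with ∈-comprehension⁻ (spread? _ _ _) y∈
      ... | fr , x , x∈ , sl with state-evades t x∈
      ...   | x₀ , ev = x₀ , prefix-extend (pos S) (moves S) t ev (slip sl) tt (λ i eq → fr i (≡.trans (position (suc t) i) eq))
        where
        slip : ∀ {x y} → Slips (Vec.lookup (proj₁ (state t))) (Vec.lookup (proj₁ (state (suc t)))) x y →
          Slips (pos S t) (pos S (suc t)) x y
        slip (inj₁ eq) = inj₁ eq
        slip (inj₂ (e , ok)) = inj₂ (e , λ i eq eq′ → ok i (≡.trans (position t i) eq) (≡.trans (position (suc t) i) eq′))

    clearable? : Dec (ClearableWith G k)
    clearable? = map′
      (λ (1≤k , s , t , init , final , star) → let R , track = transitions⇒run star in
        run⇒clearable 1≤k R (λ ev → final _ (track (subst (_ ∈_) (≡.sym init) (∈-comprehension⁺ (free? _) (proj₂ (evades-source ev)))) ev)))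
      (λ (1≤k , S , T , clear) → 1≤k , state S 0 , state S T , refl ,
        (λ x x∈ → clear x (evades⇒W S T (proj₂ (state-evades S T x∈)))) , state-transitions S T)
      ((1 ℕ.≤? k) ×-dec clears?)

-- Pathwidth and lion number of a tree.

module _ (T : Graph) (tree : IsTree T) where

  open Components T
  open Layouts T
  open Pathwidth T
  open Clearing T

  private
    positive : 0 < n T
    positive = proj₁ tree

    connected : Connected T
    connected = proj₁ (proj₂ tree)

    acyclic : Acyclic T
    acyclic = proj₂ (proj₂ tree)

  ⊤-connected : IsConnected ⊤
  ⊤-connected _ _ = lift (connected _ _)
    where
    lift : ∀ {a b} → Walk T a b → Reach (_∈ ⊤) a b
    lift here = here ∈⊤
    lift (step e w) = step ∈⊤ e (lift w)

  -- The bound on bags is applied to the decomposition with a single bag. This ends the ascent in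
  -- `optimal-layout`.
  obstruction<n : ∀ {k} → Obstruction k ⊤ → k < n T
  obstruction<n o = ℕ.≤-trans (proj₂ (obstruction⇒large-bag one-bag o)) (∣p∣≤n (⊤ ∩ ⊤))
    where
    one-bag : PathDecomposition T
    one-bag = record
      { len = 1 ; bag = λ _ → ⊤ ; cover = λ _ → fzero , ∈⊤ ; edges = λ _ _ _ → fzero , ∈⊤ , ∈⊤
      ; consecutive = λ _ _ _ _ _ _ _ _ → ∈⊤ }

  -- Obstructions have order at least 1; order 0 starts the ascent and remains the final value for a
  -- single vertex.
  Obstructed : ℕ → Set
  Obstructed p = p ≡ 0 ⊎ Obstruction p ⊤

  -- The dichotomy is asked for increasing orders until it first gives a layout; the obstruction
  -- found just before makes that layout optimal.
  optimal-layout : ∃ λ p → Obstructed p × Layout (suc p) (_∈ ⊤)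
  optimal-layout = ascend (n T) 0 (inj₁ refl) (ℕ.m≤m+n (n T) 0)
    where
    ascend : ∀ fuel p → Obstructed p → n T ≤ fuel + p → ∃ λ q → Obstructed q × Layout (suc q) (_∈ ⊤)
    ascend fuel p obstructed le with dichotomy acyclic p ⊤ ⊤-connected
    ... | inj₂ layout = p , obstructed , layout
    ascend zero p _ le | inj₁ o = contradiction (ℕ.≤-trans (obstruction<n o) le) (ℕ.<⇒≱ (ℕ.m≤n⇒m≤1+n ℕ.≤-refl))
    ascend (suc fuel) p _ le | inj₁ o =
      ascend fuel (suc p) (inj₂ o) (ℕ.≤-trans le (ℕ.≤-reflexive (≡.sym (ℕ.+-suc fuel p))))

  obstructed≤width : ∀ {p} → Obstructed p → ∀ D → p ≤ width D
  obstructed≤width (inj₁ refl) D = z≤n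
  obstructed≤width (inj₂ o) D = obstruction≤width D o

  obstructed≤lions : ∀ {p} → Obstructed p → ∀ k → ClearableWith T k → p ≤ k
  obstructed≤lions (inj₁ refl) k _ = z≤n
  obstructed≤lions (inj₂ o) k c = ℕ.≮⇒≥ λ k<p → obstruction⇒¬clearable connected acyclic o k<p c

  lion-number : ∀ {p} → Obstructed p → Layout (suc p) (_∈ ⊤) → Σ ℕ λ l → IsLionNumber T l × p ≤ l × l ≤ suc p
  lion-number {p} obstructed L with clearable? p
  ... | yes c = p , (c , obstructed≤lions obstructed) , ℕ.≤-refl , ℕ.n≤1+n p
  ... | no ¬c = suc p ,
        (layout⇒clearable connected (s≤s z≤n) positive L ,
         λ k c → ℕ.≤∧≢⇒< (obstructed≤lions obstructed k c) λ { refl → ¬c c }) ,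
        ℕ.n≤1+n p , ℕ.≤-refl

  pathwidth : ∀ {p} → Obstructed p → Layout (suc p) (_∈ ⊤) → IsPathwidth T p
  pathwidth obstructed L with layout⇒decomposition L
  ... | D , small = (D , ℕ.≤-antisym (ℕ.∸-monoˡ-≤ 1 (maxFin-lub (λ i → ∣ bag D i ∣) small)) (obstructed≤width obstructed D)) ,
        obstructed≤width obstructed

theorem14 : (T : Graph) → IsTree T →
    Σ ℕ λ p → Σ ℕ λ l → IsPathwidth T p × IsLionNumber T l × p ≤ l × l ≤ suc p
theorem14 T tree with optimal-layout T tree
... | p , obstructed , L with lion-number T tree obstructed L
...   | l , isLionNumber , lower , upper = p , l , pathwidth T tree obstructed L , isLionNumber , lower , upper
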